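{- Let $G^\sigma$ be a connected oriented unicyclic graph of order $n$ whose unique cycle $C_k^\sigma$ has length $k$, and let $\beta(G^\sigma)$ be its matching number. Then $sr(G^\sigma)=2\beta(G^\sigma)-2$ if $k$ is even, $C_k^\sigma$ is evenly-oriented and $m_{G^\sigma}(\beta(G^\sigma))=2\,m_{G^\sigma-C_k^\sigma}\big(\beta(G^\sigma)-\tfrac{k}{2}\big)$; otherwise $sr(G^\sigma)=2\beta(G^\sigma)$.
   Context: An oriented graph $G^\sigma$ is a simple graph $G$ together with an orientation of each edge. Its skew-adjacency matrix $S(G^\sigma)=(s_{ij})$ has $s_{ij}=1$ if there is an arc from $v_i$ to $v_j$, $s_{ij}=-1$ if there is an arc from $v_j$ to $v_i$, and $0$ otherwise; the skew-rank $sr(G^\sigma)$ is the rank of $S(G^\sigma)$. For an even cycle $u_1\cdots u_ku_1$, its sign is the sign of $\prod_{i=1}^k s_{u_iu_{i+1}}$ ($u_{k+1}=u_1$); the cycle is evenly-oriented if this sign is positive. $m_H(i)$ denotes the number of matchings with exactly $i$ edges in $H$, and $\beta(H)$ the matching number of $H$. $G^\sigma-C_k^\sigma$ is obtained by deleting all vertices of the cycle and their incident edges. -}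

module Defs where

open import Algebra.Properties.CommutativeMonoid.Sum using (sum)
open import Data.Bool.Base using (if_then_else_)
open import Data.Fin.Base using (Fin; zero; suc; toℕ)
open import Data.Fin.Properties using (_≟_; any?)
open import Data.Fin.Subset using (Subset; inside; outside; ∣_∣; ∁)
open import Data.List.Base
  using (List; []; _∷_; _++_; map; length; filter; allFin; cartesianProduct)
open import Data.List.Extrema.Nat using (max)
open import Data.List.Relation.Unary.AllPairs using (AllPairs; allPairs?)
open import Data.Nat.Base as ℕ using (ℕ; suc)
open import Data.Nat.Divisibility using (_∣_)
open import Data.Nat.DivMod using (_mod_)
import Data.Nat.Properties as ℕₚ
open import Data.Product.Base using (∃-syntax; Σ-syntax; _×_; _,_)
open import Data.Rational.Base using (ℚ; 0ℚ; 1ℚ; _*_; -_; _<_)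
open import Data.Rational.Properties using (+-0-commutativeMonoid; *-1-commutativeMonoid)
open import Data.Sum.Base using (_⊎_)
open import Data.Vec.Base using ([]; _∷_; tabulate)
open import Data.Vec.Functional using (Vector)
open import Function.Bundles using (_⇔_)
open import Function.Definitions using (Injective)
open import Level using (0ℓ)
open import Relation.Binary.Construct.Closure.Equivalence using (EqClosure)
open import Relation.Binary.Construct.Closure.Symmetric using (SymClosure)
open import Relation.Binary.Core using (Rel)
open import Relation.Binary.Definitions using (Asymmetric; Decidable)
open import Relation.Binary.PropositionalEquality.Core using (_≡_; _≢_)
open import Relation.Nullary.Decidable using (does; ¬?; _×-dec_)

∑ ∏ : ∀ {n} → Vector ℚ n → ℚ
∑ = sum +-0-commutativeMonoid
∏ = sum *-1-commutativeMonoid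

-- Rank of a matrix: the dimension of its column space.  The scalars are
-- rational; the rank of a rational matrix is the same over ℚ and over ℝ.

Matrix : ℕ → ℕ → Set
Matrix m n = Fin m → Fin n → ℚ

infixl 7 _*ᵥ_

_*ᵥ_ : ∀ {m n} → Matrix m n → Vector ℚ n → Vector ℚ m
(A *ᵥ c) i = ∑ λ j → A i j * c j

_∈Col_ : ∀ {m n} → Vector ℚ m → Matrix m n → Set
v ∈Col A = ∃[ c ] ∀ i → v i ≡ (A *ᵥ c) i

IndependentColumns : ∀ {m n} → Matrix m n → Set
IndependentColumns A = ∀ c → (∀ i → (A *ᵥ c) i ≡ 0ℚ) → ∀ j → c j ≡ 0ℚ

-- The columns of B are a basis, with r elements, of the column space of A.
HasRank : ∀ {m n} → Matrix m n → ℕ → Set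
HasRank {m} A r = Σ[ B ∈ Matrix m r ]
  (∀ j → (λ i → B i j) ∈Col A) ×
  IndependentColumns B ×
  (∀ v → v ∈Col A → v ∈Col B)

-- A simple graph with every edge oriented is the same thing as an
-- asymmetric relation: asymmetry excludes loops, and gives each edge of the
-- underlying graph exactly one direction.
record OrientedGraph (n : ℕ) : Set₁ where
  field
    Arc  : Rel (Fin n) 0ℓ
    arc? : Decidable Arc
    asym : Asymmetric Arc

  Adjacent : Rel (Fin n) 0ℓ
  Adjacent = SymClosure Arc

open OrientedGraph

Connected : ∀ {n} → OrientedGraph n → Set
Connected G = ∀ x y → EqClosure (Arc G) x y

skewAdjacency : ∀ {n} → OrientedGraph n → Matrix n n
skewAdjacency G i j =
  if does (arc? G i j) then 1ℚ else
  if does (arc? G j i) then - 1ℚ else 0ℚ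

HasSkewRank : ∀ {n} → OrientedGraph n → ℕ → Set
HasSkewRank G = HasRank (skewAdjacency G)

-- The increasing enumeration of the elements of a subset.
element : ∀ {n} (W : Subset n) → Fin ∣ W ∣ → Fin n
element (inside  ∷ W) zero    = zero
element (inside  ∷ W) (suc i) = suc (element W i)
element (outside ∷ W) i       = suc (element W i)

induced : ∀ {n} → OrientedGraph n → (W : Subset n) → OrientedGraph ∣ W ∣
induced G W = record
  { Arc  = λ i j → Arc G (element W i) (element W j)
  ; arc? = λ i j → arc? G (element W i) (element W j)
  ; asym = asym G
  }

-- Each edge is listed once, as a pair (tail , head).
edges : ∀ {n} → OrientedGraph n → List (Fin n × Fin n)
edges {n} G = filter (λ (i , j) → arc? G i j) (cartesianProduct (allFin n) (allFin n))

Disjoint : ∀ {n} → Rel (Fin n × Fin n) 0ℓ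
Disjoint (a , b) (c , d) = (a ≢ c × a ≢ d) × (b ≢ c × b ≢ d)

disjoint? : ∀ {n} → Decidable (Disjoint {n})
disjoint? (a , b) (c , d) =
  (¬? (a ≟ c) ×-dec ¬? (a ≟ d)) ×-dec (¬? (b ≟ c) ×-dec ¬? (b ≟ d))

-- For a list without repetitions, these are its subsets, each listed once.
sublists : ∀ {A : Set} → List A → List (List A)
sublists []       = [] ∷ []
sublists (x ∷ xs) = map (x ∷_) (sublists xs) ++ sublists xs

matchings : ∀ {n} → OrientedGraph n → List (List (Fin n × Fin n))
matchings G = filter (allPairs? disjoint?) (sublists (edges G))

-- m G i is the number of matchings with exactly i edges.
m : ∀ {n} → OrientedGraph n → ℕ → ℕ
m G i = length (filter (λ M → length M ℕₚ.≟ i) (matchings G))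

matchingNumber : ∀ {n} → OrientedGraph n → ℕ
matchingNumber G = max 0 (map length (matchings G))

-- Cyclic successor.
next : ∀ {k} → Fin k → Fin k
next {suc k} i = suc (toℕ i) mod suc k

record Cycle {n} (G : OrientedGraph n) (k : ℕ) : Set where
  field
    3≤k       : 3 ℕ.≤ k
    vertex    : Fin k → Fin n
    injective : Injective _≡_ _≡_ vertex
    adjacent  : ∀ i → Adjacent G (vertex i) (vertex (next i))

open Cycle

module _ {n} {G : OrientedGraph n} where

  EdgeOf : ∀ {k} → Cycle G k → Rel (Fin n) 0ℓ
  EdgeOf C x y = ∃[ i ]
    ((x ≡ vertex C i × y ≡ vertex C (next i)) ⊎
     (y ≡ vertex C i × x ≡ vertex C (next i)))

  -- A Cycle carries a starting vertex and a direction of traversal, so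
  -- equality of cycles as subgraphs is equality of their edge sets.
  IsUniqueCycle : ∀ {k} → Cycle G k → Set
  IsUniqueCycle C = ∀ {l} (D : Cycle G l) x y → EdgeOf D x y ⇔ EdgeOf C x y

  -- Meaningful for even k only: the sign of the product then does not depend
  -- on the direction of traversal.
  EvenlyOriented : ∀ {k} → Cycle G k → Set
  EvenlyOriented C =
    0ℚ < ∏ λ i → skewAdjacency G (vertex C i) (vertex C (next i))

  vertexSet : ∀ {k} → Cycle G k → Subset n
  vertexSet C = tabulate λ x → does (any? λ i → vertex C i ≟ x)

infixl 6 _─_

_─_ : ∀ {n k} (G : OrientedGraph n) (C : Cycle G k) → OrientedGraph ∣ ∁ (vertexSet C) ∣
G ─ C = induced G (∁ (vertexSet C))

-- The subtraction never truncates: the matching number of G is at least k / 2,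
-- since an even cycle C has a matching of k / 2 edges.
Exceptional : ∀ {n k} (G : OrientedGraph n) → Cycle G k → Set
Exceptional {k = k} G C =
  2 ∣ k ×
  EvenlyOriented C ×
  m G (matchingNumber G) ≡ 2 ℕ.* m (G ─ C) (matchingNumber G ℕ.∸ k ℕ./ 2)

{-# OPTIONS --safe #-}

-- Deleting an isolated vertex from an induced subgraph changes neither the
-- skew-rank nor the matching number; deleting a pendant vertex together with
-- its neighbour lowers the rank by 2 and the matching number by 1.  A set of
-- vertices that induces minimum degree at least 2 is empty or equal to C, for
-- otherwise a non-backtracking walk closes a second cycle; so the reduction
-- ends in the empty graph or in C.  On C the kernel equations, twisted by the
-- partial products of the signs, become y (i + 2) = y i with y (i + k) = ± y i,
-- where ± is the sign of the cycle; hence C has rank k - 1 for odd k, k - 2 for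
-- even k and positive sign, and k otherwise, so that rank and 2 β differ (by 2)
-- only if the reduction ends in an evenly-oriented even C.
--
-- For even k, the maximum matchings containing one of the two perfect
-- matchings of C number 2 m (G - C) (β - k/2), so the equation in the
-- statement says that every maximum matching of G saturates C within C.  This
-- is preserved by the reduction in both directions: it holds if the reduction
-- ends in C, and it fails if the reduction ends in the empty graph.

module Submission where

open import Defs
open import Algebra.Bundles using (CommutativeRing)
open import Data.Bool.Base using (true; false; if_then_else_)
open import Data.Empty using (⊥; ⊥-elim)
open import Data.Fin.Base using (Fin; zero; suc; toℕ; fromℕ<)
open import Data.Fin.Properties
  using (suc-injective; toℕ<n; toℕ-injective; toℕ-fromℕ<; any?; pigeonhole)
  renaming (_≟_ to _≟ᶠ_)
open import Data.Fin.Subset using (Subset; inside; outside; ∁; ∣_∣; _-_)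
  renaming (_∈_ to _∈ˢ_; _∉_ to _∉ˢ_; _⊆_ to _⊆ˢ_; _─_ to _∖_; ⊥ to ∅; ⊤ to Full)
import Data.Fin.Subset.Properties as Subset
import Data.Integer.Base as ℤ
open import Data.List.Base
  using (List; []; _∷_; _++_; map; length; filter; allFin; cartesianProduct; lookup; applyUpTo)
open import Data.List.Extrema.Nat using (max; xs≤max; argmax-sel)
open import Data.List.Membership.Propositional using (_∈_; _∉_; find)
open import Data.List.Membership.Propositional.Properties
open import Data.List.Properties using (length-map; length-++; length-applyUpTo; ∷-injectiveʳ)
open import Data.List.Relation.Binary.Subset.Propositional using (_⊆_)
open import Data.List.Relation.Unary.All as All using (All; []; _∷_)
open import Data.List.Relation.Unary.All.Properties using (¬All⇒Any¬)
open import Data.List.Relation.Unary.AllPairs as AllPairs using (AllPairs; []; _∷_; allPairs?)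
open import Data.List.Relation.Unary.Any using (here; there; index)
open import Data.List.Relation.Unary.Any.Properties using (lookup-index)
open import Data.List.Relation.Unary.Unique.Propositional using (Unique)
import Data.List.Relation.Unary.Unique.Propositional.Properties as Unique
open import Data.Nat.Base
  using (ℕ; zero; suc; _+_; _*_; _∸_; _/_; _%_; _≤_; _<_; z≤n; s≤s; z<s; s<s; NonZero)
open import Data.Nat.Divisibility using (divides)
open import Data.Nat.DivMod
  using (_mod_; m%n<n; m<n⇒m%n≡m; %-distribˡ-+; m%n%n≡m%n; [m+n]%n≡m%n; n%n≡0; m*n/n≡m; m≡m%n+[m/n]*n)
open import Data.Nat.Induction using (<-wellFounded)
import Data.Nat.Properties as ℕₚ
open import Data.Product.Base using (Σ-syntax; ∃-syntax; ∃₂; _×_; _,_; proj₁; proj₂; uncurry)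
open import Data.Product.Properties using (≡-dec)
open import Data.Rational.Base as ℚ using (ℚ; 0ℚ; 1ℚ)
import Data.Rational.Properties as ℚₚ
open import Data.Sum.Base using (_⊎_; inj₁; inj₂; [_,_]′; swap)
open import Data.Vec.Base using (_∷_) renaming (here to hereᵛ; there to thereᵛ)
open import Data.Vec.Functional using (Vector)
open import Data.Vec.Properties using (lookup⇒[]=; []=⇒lookup; lookup∘tabulate)
open import Function.Base using (_∘_; id; case_of_)
open import Function.Bundles using (module Equivalence)
open import Induction.WellFounded using (Acc; acc)
open import Relation.Binary.Construct.Closure.Symmetric as SymClosure using (fwd; bwd)
open import Relation.Binary.Definitions using (DecidableEquality; tri<; tri≈; tri>)
open import Relation.Binary.PropositionalEquality
  using (_≡_; _≢_; refl; sym; trans; cong; cong₂; subst; subst₂; module ≡-Reasoning)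
open import Relation.Nullary.Decidable
  using (Dec; yes; no; does; toSum; from-yes; from-no; ¬?; _×-dec_; _⊎-dec_;
         decidable-stable; dec-true; dec-false)
open import Relation.Nullary.Negation.Core using (¬_; contradiction)
open import Relation.Unary using (Decidable)

open import Algebra.Properties.CommutativeMonoid.Sum ℚₚ.+-0-commutativeMonoid
  using (∑-distrib-+; ∑-comm; sum-cong-≗)
open import Algebra.Properties.CommutativeMonoid.Sum ℚₚ.*-1-commutativeMonoid
  using () renaming (sum-cong-≗ to ∏-cong)
open import Algebra.Properties.Semiring.Sum (CommutativeRing.semiring ℚₚ.+-*-commutativeRing)
  using (*-distribˡ-sum)

open OrientedGraph using (Adjacent)
open Cycle

-- The equation between numbers of matchings cannot be followed through the reduction: deleting a
-- pendant pair can change the number of maximum matchings by a large factor. It is exchanged for a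
-- property of single matchings, and the two directions then ask for different things. If the
-- reduction ends in the cycle, an arbitrary maximum matching has to be restricted step by step; if
-- it ends in the empty graph, one well-chosen maximum matching is enough, and it is built backwards
-- from the empty one. The rank is followed in a form adapted to back-substitution. Every subgraph
-- of the reduction is a subset of the fixed vertex set, and vectors always have all `n`
-- coordinates. That some columns form a basis is recorded by the shape of the kernel: the other
-- coordinates of a kernel vector are free and determine it. A pendant pair adds two coordinates to
-- the determined side, an isolated vertex adds a free one, and on the cycle the kernel is explicit.
-- Only `G ─ C`, which the statement itself reindexes, needs a translation of edges.

module _ {A : Set} where

  -- Lists without repetitions and their sublists

  Unique⊆⇒length≤ : {xs ys : List A} → Unique xs → xs ⊆ ys → length xs ≤ length ys
  Unique⊆⇒length≤ [] _ = z≤n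
  Unique⊆⇒length≤ {x ∷ xs} (x≢ ∷ u) sub with ∈-∃++ (sub (here refl))
  ... | as , bs , refl = ℕₚ.≤-trans (s≤s (Unique⊆⇒length≤ u sub′)) (ℕₚ.≤-reflexive lengths)
    where
    sub′ : xs ⊆ as ++ bs
    sub′ y∈xs with ∈-++⁻ as (sub (there y∈xs))
    ... | inj₁ y∈as         = ∈-++⁺ˡ y∈as
    ... | inj₂ (here y≡x)   = contradiction (sym y≡x) (All.lookup x≢ y∈xs)
    ... | inj₂ (there y∈bs) = ∈-++⁺ʳ as y∈bs
    lengths : suc (length (as ++ bs)) ≡ length (as ++ x ∷ bs)
    lengths rewrite length-++ as {bs} | length-++ as {x ∷ bs} = sym (ℕₚ.+-suc (length as) (length bs))

  Unique⊆⊇⇒length≡ : {xs ys : List A} → Unique xs → Unique ys → xs ⊆ ys → ys ⊆ xs →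
    length xs ≡ length ys
  Unique⊆⊇⇒length≡ u v s t = ℕₚ.≤-antisym (Unique⊆⇒length≤ u s) (Unique⊆⇒length≤ v t)

  ∉∷-unique : ∀ {x} {xs : List A} → x ∉ xs → Unique xs → Unique (x ∷ xs)
  ∉∷-unique x∉xs u = All.tabulate (λ y∈xs x≡y → x∉xs (subst (_∈ _) (sym x≡y) y∈xs)) ∷ u

  module _ (_≟_ : DecidableEquality A) where

    open import Data.List.Membership.DecPropositional _≟_ using (_∈?_)

    Unique⊆∧length≥⇒⊇ : {xs ys : List A} → Unique xs → xs ⊆ ys → length ys ≤ length xs → ys ⊆ xs
    Unique⊆∧length≥⇒⊇ {xs} {ys} u sub le {y} y∈ys with y ∈? xs
    ... | yes y∈xs = y∈xs
    ... | no  y∉xs = contradiction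
      (ℕₚ.≤-trans (Unique⊆⇒length≤ (∉∷-unique y∉xs u) λ { (here refl) → y∈ys ; (there z) → sub z }) le)
      (ℕₚ.<-irrefl refl)

  filter∈sublists : ∀ {P : A → Set} (P? : Decidable P) xs → filter P? xs ∈ sublists xs
  filter∈sublists P? [] = here refl
  filter∈sublists P? (x ∷ xs) with does (P? x)
  ... | true  = ∈-++⁺ˡ (∈-map⁺ (x ∷_) (filter∈sublists P? xs))
  ... | false = ∈-++⁺ʳ (map (x ∷_) (sublists xs)) (filter∈sublists P? xs)

  ∈sublists⇒⊆ : ∀ xs {ys : List A} → ys ∈ sublists xs → ys ⊆ xs
  ∈sublists⇒⊆ [] (here refl) ()
  ∈sublists⇒⊆ (x ∷ xs) ys∈ with ∈-++⁻ (map (x ∷_) (sublists xs)) ys∈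
  ... | inj₂ ys∈′ = there ∘ ∈sublists⇒⊆ xs ys∈′
  ... | inj₁ ys∈′ with ∈-map⁻ (x ∷_) ys∈′
  ...   | zs , zs∈ , refl = λ { (here e) → here e ; (there z) → there (∈sublists⇒⊆ xs zs∈ z) }

  -- A sublist keeps the order of the repetition-free list it is taken from, so its set of entries
  -- determines it. This is why counting lists of edges counts sets of edges.
  sublists-ext : ∀ {xs ys zs : List A} → Unique xs → ys ∈ sublists xs → zs ∈ sublists xs →
    ys ⊆ zs → zs ⊆ ys → ys ≡ zs
  sublists-ext {[]} u (here refl) (here refl) _ _ = refl
  sublists-ext {x ∷ xs} (x≢ ∷ u) ys∈ zs∈ s t
    with ∈-++⁻ (map (x ∷_) (sublists xs)) ys∈ | ∈-++⁻ (map (x ∷_) (sublists xs)) zs∈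
  ... | inj₂ ys∈′ | inj₂ zs∈′ = sublists-ext u ys∈′ zs∈′ s t
  ... | inj₁ ys∈′ | inj₂ zs∈′ with ∈-map⁻ (x ∷_) ys∈′
  ...   | _ , _ , refl = contradiction refl (All.lookup x≢ (∈sublists⇒⊆ xs zs∈′ (s (here refl))))
  sublists-ext {x ∷ xs} (x≢ ∷ u) ys∈ zs∈ s t | inj₂ ys∈′ | inj₁ zs∈′ with ∈-map⁻ (x ∷_) zs∈′
  ...   | _ , _ , refl = contradiction refl (All.lookup x≢ (∈sublists⇒⊆ xs ys∈′ (t (here refl))))
  sublists-ext {x ∷ xs} (x≢ ∷ u) ys∈ zs∈ s t | inj₁ ys∈′ | inj₁ zs∈′
    with ∈-map⁻ (x ∷_) ys∈′ | ∈-map⁻ (x ∷_) zs∈′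
  ...   | ys , ys∈″ , refl | zs , zs∈″ , refl =
    cong (x ∷_) (sublists-ext u ys∈″ zs∈″ (strip ys∈″ s) (strip zs∈″ t))
    where
    strip : ∀ {as bs} → as ∈ sublists xs → x ∷ as ⊆ x ∷ bs → as ⊆ bs
    strip as∈ sub a∈as with sub (there a∈as)
    ... | here refl  = contradiction refl (All.lookup x≢ (∈sublists⇒⊆ xs as∈ a∈as))
    ... | there a∈bs = a∈bs

  sublists-unique : ∀ {xs : List A} → Unique xs → Unique (sublists xs)
  sublists-unique [] = [] ∷ []
  sublists-unique {x ∷ xs} (x≢ ∷ u) =
    Unique.++⁺ (Unique.map⁺ ∷-injectiveʳ (sublists-unique u)) (sublists-unique u) disjoint
    where
    disjoint : ∀ {ys} → ¬ (ys ∈ map (x ∷_) (sublists xs) × ys ∈ sublists xs)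
    disjoint (ys∈ , ys∈′) with ∈-map⁻ (x ∷_) ys∈
    ... | _ , _ , refl = All.lookup x≢ (∈sublists⇒⊆ xs ys∈′ (here refl)) refl

max-map∈ : ∀ {A : Set} (f : A → ℕ) xs x → x ∈ xs → ∃[ y ] y ∈ xs × f y ≡ max 0 (map f xs)
max-map∈ f xs x x∈xs with argmax-sel id 0 (map f xs)
... | inj₂ max∈ with ∈-map⁻ f max∈
...   | y , y∈xs , eq = y , y∈xs , sym eq
-- The maximum is the default value 0; then `f x` is 0 as well, so `x` attains it.
max-map∈ f xs x x∈xs | inj₁ max≡0 = x , x∈xs , trans (ℕₚ.n≤0⇒n≡0 le) (sym max≡0)
  where
  le : f x ≤ 0
  le = subst (f x ≤_) max≡0 (All.lookup (xs≤max 0 (map f xs)) (∈-map⁺ f x∈xs))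

-- Matchings within a set of vertices

Edge : ℕ → Set
Edge n = Fin n × Fin n

_≟ᴱ_ : ∀ {n} → DecidableEquality (Edge n)
_≟ᴱ_ = ≡-dec _≟ᶠ_ _≟ᶠ_

module _ {n : ℕ} where

  open import Data.List.Membership.DecPropositional (_≟ᴱ_ {n}) using () renaming (_∈?_ to _∈ᴱ?_) public

Incident : ∀ {n} → Fin n → Edge n → Set
Incident x (a , b) = x ≡ a ⊎ x ≡ b

incident? : ∀ {n} (x : Fin n) e → Dec (Incident x e)
incident? x (a , b) = (x ≟ᶠ a) ⊎-dec (x ≟ᶠ b)

module _ {n} (G : OrientedGraph n) where

  open OrientedGraph G

  -- The subgraph on `W` is never formed, so no edge is renamed when vertices are deleted. `meet`
  -- speaks of membership only, so, unlike disjointness of list entries in pairs, it does not depend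
  -- on how the edges are listed.
  record Matching (W : Subset n) (M : List (Edge n)) : Set where
    field
      arc    : ∀ {a b} → (a , b) ∈ M → Arc a b
      within : ∀ {e x} → e ∈ M → Incident x e → x ∈ˢ W
      meet   : ∀ {e f x} → e ∈ M → f ∈ M → Incident x e → Incident x f → e ≡ f
      unique : Unique M

  record MaximumMatching (W : Subset n) (M : List (Edge n)) : Set where
    field
      matching : Matching W M
      maximum  : ∀ {N} → Matching W N → length N ≤ length M

open Matching
open MaximumMatching

disjoint : ∀ {n} {e f : Edge n} → (∀ x → Incident x e → Incident x f → e ≡ f) → e ≢ f → Disjoint e f
disjoint meets e≢f =
  ((λ { refl → e≢f (meets _ (inj₁ refl) (inj₁ refl)) }) ,
   (λ { refl → e≢f (meets _ (inj₁ refl) (inj₂ refl)) })) ,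
  ((λ { refl → e≢f (meets _ (inj₂ refl) (inj₁ refl)) }) ,
   (λ { refl → e≢f (meets _ (inj₂ refl) (inj₂ refl)) }))

disjoint⇒¬incident : ∀ {n} {e f : Edge n} {x} → Disjoint e f → Incident x e → ¬ Incident x f
disjoint⇒¬incident ((p , q) , _) (inj₁ refl) = [ p , q ]′
disjoint⇒¬incident (_ , (p , q)) (inj₂ refl) = [ p , q ]′

module _ {n} {G : OrientedGraph n} where

  open OrientedGraph G

  ∈edges⁺ : ∀ {a b} → Arc a b → (a , b) ∈ edges G
  ∈edges⁺ {a} {b} ab =
    ∈-filter⁺ (λ (i , j) → arc? i j) (∈-cartesianProduct⁺ (∈-allFin a) (∈-allFin b)) ab

  ∈edges⁻ : ∀ {a b} → (a , b) ∈ edges G → Arc a b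
  ∈edges⁻ e∈ =
    proj₂ (∈-filter⁻ (λ (i , j) → arc? i j) {xs = cartesianProduct (allFin n) (allFin n)} e∈)

  edges-unique : Unique (edges G)
  edges-unique = Unique.filter⁺ (λ (i , j) → arc? i j)
    (Unique.cartesianProduct⁺ (Unique.allFin⁺ n) (Unique.allFin⁺ n))

  ∈matchings⇒∈sublists : ∀ {M} → M ∈ matchings G → M ∈ sublists (edges G)
  ∈matchings⇒∈sublists M∈ = proj₁ (∈-filter⁻ (allPairs? (disjoint? {n})) {xs = sublists (edges G)} M∈)

  ∈matchings⇒Matching : ∀ {M} → M ∈ matchings G → Matching G Full M
  ∈matchings⇒Matching {M} M∈ = record
    { arc    = λ e∈M → ∈edges⁻ (∈sublists⇒⊆ (edges G) (∈matchings⇒∈sublists M∈) e∈M)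
    ; within = λ _ _ → Subset.∈⊤
    ; meet   = λ e∈M f∈M xe xf → case ∈-AllPairs₂ pairs e∈M f∈M of λ
        { (inj₁ e≡f)        → e≡f
        ; (inj₂ (inj₁ d)) → contradiction xf (disjoint⇒¬incident d xe)
        ; (inj₂ (inj₂ d)) → contradiction xe (disjoint⇒¬incident d xf)
        }
    ; unique = AllPairs.map (λ { ((a≢c , _) , _) refl → a≢c refl }) pairs
    }
    where
    pairs : AllPairs (Disjoint {n}) M
    pairs = proj₂ (∈-filter⁻ (allPairs? (disjoint? {n})) {xs = sublists (edges G)} M∈)

  pairwiseDisjoint : ∀ {M} → (∀ {e f x} → e ∈ M → f ∈ M → Incident x e → Incident x f → e ≡ f) →
    Unique M → AllPairs (Disjoint {n}) M
  pairwiseDisjoint meets [] = []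
  pairwiseDisjoint {e ∷ M} meets (e≢ ∷ u) =
    All.tabulate (λ f∈M → disjoint (λ _ → meets (here refl) (there f∈M)) (All.lookup e≢ f∈M)) ∷
    pairwiseDisjoint (λ f∈M g∈M → meets (there f∈M) (there g∈M)) u

  -- The list of matchings contains each matching in exactly one ordering.
  ordered : List (Edge n) → List (Edge n)
  ordered M = filter (_∈ᴱ? M) (edges G)

  ordered-⊆ : ∀ {M} → ordered M ⊆ M
  ordered-⊆ {M} e∈ = proj₂ (∈-filter⁻ (_∈ᴱ? M) {xs = edges G} e∈)

  module _ {W M} (isM : Matching G W M) where

    ordered-⊇ : M ⊆ ordered M
    ordered-⊇ e∈M = ∈-filter⁺ (_∈ᴱ? M) (∈edges⁺ (arc isM e∈M)) e∈M

    ordered-length : length (ordered M) ≡ length M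
    ordered-length =
      Unique⊆⊇⇒length≡ (Unique.filter⁺ (_∈ᴱ? M) edges-unique) (unique isM) ordered-⊆ ordered-⊇

    ordered∈matchings : ordered M ∈ matchings G
    ordered∈matchings = ∈-filter⁺ (allPairs? (disjoint? {n})) (filter∈sublists (_∈ᴱ? M) (edges G))
      (pairwiseDisjoint (λ e∈ f∈ → meet isM (ordered-⊆ e∈) (ordered-⊆ f∈))
        (Unique.filter⁺ (_∈ᴱ? M) edges-unique))

    length≤matchingNumber : length M ≤ matchingNumber G
    length≤matchingNumber = subst (_≤ matchingNumber G) ordered-length
      (All.lookup (xs≤max 0 (map length (matchings G))) (∈-map⁺ length ordered∈matchings))

  matchings-unique : Unique (matchings G)
  matchings-unique = Unique.filter⁺ (allPairs? (disjoint? {n})) (sublists-unique edges-unique)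

  matchings-ext : ∀ {M N} → M ∈ matchings G → N ∈ matchings G → M ⊆ N → N ⊆ M → M ≡ N
  matchings-ext M∈ N∈ =
    sublists-ext edges-unique (∈matchings⇒∈sublists M∈) (∈matchings⇒∈sublists N∈)

  []-matching : ∀ {W} → Matching G W []
  []-matching = record { arc = λ () ; within = λ () ; meet = λ () ; unique = [] }

  maximum-length : ∀ {M} → MaximumMatching G Full M → length M ≡ matchingNumber G
  maximum-length {M} isMax
    -- A maximum is attained on a nonempty list; the empty matching is always available.
    with max-map∈ length (matchings G) (ordered []) (ordered∈matchings {W = Full} []-matching)
  ... | N , N∈ , eq = ℕₚ.≤-antisym (length≤matchingNumber (matching isMax))
    (subst (_≤ length M) eq (maximum isMax (∈matchings⇒Matching N∈)))

x∈p-y⇒x∈p : ∀ {n} {p : Subset n} {x y} → x ∈ˢ p - y → x ∈ˢ p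
x∈p-y⇒x∈p {p = p} = Subset.p─q⊆p p _

x∈p-y⇒x≢y : ∀ {n} {p : Subset n} {x y} → x ∈ˢ p - y → x ≢ y
x∈p-y⇒x≢y {y = y} x∈ refl = ∉─ _ _ x∈ (Subset.x∈⁅x⁆ y)
  where
  ∉─ : ∀ {n x} (p q : Subset n) → x ∈ˢ p ∖ q → x ∉ˢ q
  ∉─ (_ ∷ p) (outside ∷ q) (thereᵛ x∈) (thereᵛ x∈q) = ∉─ p q x∈ x∈q
  ∉─ (_ ∷ p) (inside ∷ q)  (thereᵛ x∈) (thereᵛ x∈q) = ∉─ p q x∈ x∈q

lookup-injective : ∀ {A : Set} {xs : List A} → Unique xs →
  ∀ i j → lookup xs i ≡ lookup xs j → i ≡ j
lookup-injective (_ ∷ _)  zero    zero    _  = refl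
lookup-injective (x≢ ∷ _) zero    (suc j) eq = contradiction eq (All.lookup x≢ (∈-lookup j))
lookup-injective (x≢ ∷ _) (suc i) zero    eq = contradiction (sym eq) (All.lookup x≢ (∈-lookup i))
lookup-injective (_ ∷ u)  (suc i) (suc j) eq = cong suc (lookup-injective u i j eq)

-- Vectors, sums, and the rank of principal submatrices

infixl 6 _+ᵥ_

_+ᵥ_ : ∀ {n} → Vector ℚ n → Vector ℚ n → Vector ℚ n
(x +ᵥ y) i = x i ℚ.+ y i

abstract

  single : ∀ {n} → Fin n → ℚ → Vector ℚ n
  single a t i = if does (i ≟ᶠ a) then t else 0ℚ

  single-≡ : ∀ {n} (a : Fin n) t → single a t a ≡ t
  single-≡ a t rewrite dec-true (a ≟ᶠ a) refl = refl

  single-≢ : ∀ {n} {a i : Fin n} t → i ≢ a → single a t i ≡ 0ℚ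
  single-≢ {a = a} {i} t i≢a rewrite dec-false (i ≟ᶠ a) i≢a = refl

+-single-≡ : ∀ {n} (x : Vector ℚ n) a t → x a ≡ 0ℚ → (x +ᵥ single a t) a ≡ t
+-single-≡ x a t xa≡0 = trans (cong₂ ℚ._+_ xa≡0 (single-≡ a t)) (ℚₚ.+-identityˡ t)

+-single-≢ : ∀ {n} (x : Vector ℚ n) {a i} t → i ≢ a → (x +ᵥ single a t) i ≡ x i
+-single-≢ x {i = i} t i≢a = trans (cong (x i ℚ.+_) (single-≢ t i≢a)) (ℚₚ.+-identityʳ (x i))

∑-zero : ∀ {n} (f : Vector ℚ n) → (∀ j → f j ≡ 0ℚ) → ∑ f ≡ 0ℚ
∑-zero {zero}  f f≡0 = refl
∑-zero {suc n} f f≡0 = cong₂ ℚ._+_ (f≡0 zero) (∑-zero (f ∘ suc) (f≡0 ∘ suc))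

∑-single : ∀ {n} (f : Vector ℚ n) a → (∀ j → j ≢ a → f j ≡ 0ℚ) → ∑ f ≡ f a
∑-single f zero f≡0 =
  trans (cong (f zero ℚ.+_) (∑-zero (f ∘ suc) (λ j → f≡0 (suc j) λ ()))) (ℚₚ.+-identityʳ _)
∑-single f (suc a) f≡0 =
  trans (cong₂ ℚ._+_ (f≡0 zero λ ()) (∑-single (f ∘ suc) a λ j j≢a → f≡0 (suc j) λ { refl → j≢a refl }))
    (ℚₚ.+-identityˡ _)

∑-pair : ∀ {n} (f : Vector ℚ n) {a b} → a ≢ b → (∀ j → j ≢ a → j ≢ b → f j ≡ 0ℚ) →
  ∑ f ≡ f a ℚ.+ f b
∑-pair f {zero}  {zero}  a≢b f≡0 = contradiction refl a≢b
∑-pair f {zero}  {suc b} a≢b f≡0 =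
  cong (f zero ℚ.+_) (∑-single (f ∘ suc) b λ j j≢b → f≡0 (suc j) (λ ()) λ { refl → j≢b refl })
∑-pair f {suc a} {zero}  a≢b f≡0 =
  trans (cong (f zero ℚ.+_) (∑-single (f ∘ suc) a λ j j≢a → f≡0 (suc j) (λ { refl → j≢a refl }) λ ()))
    (ℚₚ.+-comm (f zero) _)
∑-pair f {suc a} {suc b} a≢b f≡0 =
  trans (cong₂ ℚ._+_ (f≡0 zero (λ ()) λ ())
          (∑-pair (f ∘ suc) (a≢b ∘ cong suc)
            λ j j≢a j≢b → f≡0 (suc j) (λ { refl → j≢a refl }) λ { refl → j≢b refl }))
    (ℚₚ.+-identityˡ _)

*ᵥ-+ᵥ : ∀ {m n} (A : Matrix m n) x y i → (A *ᵥ (x +ᵥ y)) i ≡ (A *ᵥ x) i ℚ.+ (A *ᵥ y) i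
*ᵥ-+ᵥ A x y i = trans (sum-cong-≗ λ j → ℚₚ.*-distribˡ-+ (A i j) (x j) (y j))
  (∑-distrib-+ (λ j → A i j ℚ.* x j) λ j → A i j ℚ.* y j)

*ᵥ-cong : ∀ {m n} (A : Matrix m n) {x y} → (∀ j → x j ≡ y j) → ∀ i → (A *ᵥ x) i ≡ (A *ᵥ y) i
*ᵥ-cong A x≡y i = sum-cong-≗ λ j → cong (A i j ℚ.*_) (x≡y j)

x*0≡0 : ∀ x {y} → y ≡ 0ℚ → x ℚ.* y ≡ 0ℚ
x*0≡0 x refl = ℚₚ.*-zeroʳ x

0*y≡0 : ∀ {x} y → x ≡ 0ℚ → x ℚ.* y ≡ 0ℚ
0*y≡0 y refl = ℚₚ.*-zeroˡ y

*ᵥ-single : ∀ {m n} (A : Matrix m n) a t i → (A *ᵥ single a t) i ≡ A i a ℚ.* t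
*ᵥ-single A a t i = trans
  (∑-single (λ j → A i j ℚ.* single a t j) a λ j j≢a → x*0≡0 (A i j) (single-≢ t j≢a))
  (cong (A i a ℚ.*_) (single-≡ a t))

*ᵥ-+-single : ∀ {m n} (A : Matrix m n) x a t i →
  (A *ᵥ (x +ᵥ single a t)) i ≡ (A *ᵥ x) i ℚ.+ A i a ℚ.* t
*ᵥ-+-single A x a t i =
  trans (*ᵥ-+ᵥ A x (single a t) i) (cong ((A *ᵥ x) i ℚ.+_) (*ᵥ-single A a t i))

-- Matrix entries at edges and products of them are signs, hence their own inverses; this stands in
-- for division.
involution-cancelˡ : ∀ s z → s ℚ.* s ≡ 1ℚ → s ℚ.* (s ℚ.* z) ≡ z
involution-cancelˡ s z ss≡1 =
  trans (sym (ℚₚ.*-assoc s s z)) (trans (cong (ℚ._* z) ss≡1) (ℚₚ.*-identityˡ z))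

involution-zero : ∀ s z → s ℚ.* s ≡ 1ℚ → s ℚ.* z ≡ 0ℚ → z ≡ 0ℚ
involution-zero s z ss≡1 sz≡0 =
  trans (sym (involution-cancelˡ s z ss≡1)) (x*0≡0 s sz≡0)

module _ {n} (A : Matrix n n) where

  -- The kernel of the principal submatrix A[W], its vectors extended by 0 to all indices.
  record Kernel (W : Subset n) (x : Vector ℚ n) : Set where
    field
      support : ∀ {i} → i ∉ˢ W → x i ≡ 0ℚ
      vanish  : ∀ {i} → i ∈ˢ W → (A *ᵥ x) i ≡ 0ℚ

  -- The columns of the submatrix A[W] with indices in us form a basis of its
  -- column space.  In terms of the kernel of A[W]: its elements are
  -- determined, freely, by their coordinates outside us.
  record ColumnBasis (W : Subset n) (us : List (Fin n)) : Set where
    field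
      unique  : Unique us
      members : ∀ {i} → i ∈ us → i ∈ˢ W
      extend  : ∀ (f : Vector ℚ n) →
        ∃[ x ] Kernel W x × (∀ {i} → i ∈ˢ W → i ∉ us → x i ≡ f i)
      trivial : ∀ {x} → Kernel W x → (∀ {i} → i ∉ us → x i ≡ 0ℚ) → ∀ i → x i ≡ 0ℚ

open Kernel
open ColumnBasis

module _ {n} {A : Matrix n n} where

  open import Data.List.Membership.DecPropositional (_≟ᶠ_ {n}) using () renaming (_∈?_ to _∈ᶠ?_)

  ∅-columnBasis : ColumnBasis A ∅ []
  ∅-columnBasis = record
    { unique  = []
    ; members = λ ()
    ; extend  = λ f → (λ _ → 0ℚ) ,
        record { support = λ _ → refl ; vanish = λ i∈ → contradiction i∈ Subset.∉⊥ } ,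
        λ i∈ → contradiction i∈ Subset.∉⊥
    ; trivial = λ ker _ i → support ker Subset.∉⊥
    }

  combination : ∀ (us : List (Fin n)) → Vector ℚ (length us) → Vector ℚ n
  combination us c i = ∑ λ j → single (lookup us j) (c j) i

  module _ (us : List (Fin n)) (c : Vector ℚ (length us)) where

    combination-∉ : ∀ {i} → i ∉ us → combination us c i ≡ 0ℚ
    combination-∉ i∉us = ∑-zero _ λ j → single-≢ (c j) λ { refl → i∉us (∈-lookup j) }

    combination-lookup : Unique us → ∀ j → combination us c (lookup us j) ≡ c j
    combination-lookup u j = trans
      (∑-single _ j λ l l≢j → single-≢ (c l) (l≢j ∘ sym ∘ lookup-injective u j l))
      (single-≡ (lookup us j) (c j))

    *ᵥ-combination : ∀ i → (A *ᵥ combination us c) i ≡ ∑ λ j → A i (lookup us j) ℚ.* c j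
    *ᵥ-combination i = begin
      (∑ λ l → A i l ℚ.* combination us c l)
        ≡⟨ sum-cong-≗ (λ l → *-distribˡ-sum (A i l) λ j → single (lookup us j) (c j) l) ⟩
      (∑ λ l → ∑ λ j → A i l ℚ.* single (lookup us j) (c j) l)
        ≡⟨ ∑-comm (λ l j → A i l ℚ.* single (lookup us j) (c j) l) ⟩
      (∑ λ j → ∑ λ l → A i l ℚ.* single (lookup us j) (c j) l)
        ≡⟨ sum-cong-≗ (λ j → *ᵥ-single A (lookup us j) (c j) i) ⟩
      (∑ λ j → A i (lookup us j) ℚ.* c j) ∎
      where open ≡-Reasoning

  -- A linear relation between the columns in `us` is a kernel vector that is 0 elsewhere, so
  -- `trivial` gives independence. For spanning, subtract from `c` the kernel vector that agrees
  -- with it outside `us`: the product with `A` is unchanged, and only coordinates in `us` remain.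
  columnBasis⇒hasRank : ∀ {us} → ColumnBasis A Full us → HasRank A (length us)
  columnBasis⇒hasRank {us} basis = B , columns , independent , spanning
    where
    B : Matrix n (length us)
    B i j = A i (lookup us j)

    columns : ∀ j → (λ i → B i j) ∈Col A
    columns j = single (lookup us j) 1ℚ ,
      λ i → sym (trans (*ᵥ-single A (lookup us j) 1ℚ i) (ℚₚ.*-identityʳ _))

    independent : IndependentColumns B
    independent c Bc≡0 j = trans (sym (combination-lookup us c (unique basis) j))
      (trivial basis
        (record { support = λ i∉ → contradiction Subset.∈⊤ i∉
                ; vanish  = λ {i} _ → trans (*ᵥ-combination us c i) (Bc≡0 i) })
        (combination-∉ us c) (lookup us j))

    spanning : ∀ v → v ∈Col A → v ∈Col B
    spanning v (c , v≡Ac) with extend basis c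
    ... | x , ker , agree = d , λ i → begin
      v i                                               ≡⟨ v≡Ac i ⟩
      (A *ᵥ c) i                                        ≡⟨ *ᵥ-cong A decompose i ⟩
      (A *ᵥ (x +ᵥ combination us d)) i                  ≡⟨ *ᵥ-+ᵥ A x (combination us d) i ⟩
      (A *ᵥ x) i ℚ.+ (A *ᵥ combination us d) i
        ≡⟨ cong₂ ℚ._+_ (vanish ker Subset.∈⊤) (*ᵥ-combination us d i) ⟩
      0ℚ ℚ.+ (B *ᵥ d) i                                 ≡⟨ ℚₚ.+-identityˡ _ ⟩
      (B *ᵥ d) i                                        ∎
      where
      open ≡-Reasoning
      d : Vector ℚ (length us)
      d j = c (lookup us j) ℚ.- x (lookup us j)

      cancel : ∀ a b → a ≡ b ℚ.+ (a ℚ.- b)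
      cancel a b = sym (trans (cong (b ℚ.+_) (ℚₚ.+-comm a (ℚ.- b)))
        (trans (sym (ℚₚ.+-assoc b (ℚ.- b) a))
          (trans (cong (ℚ._+ a) (ℚₚ.+-inverseʳ b)) (ℚₚ.+-identityˡ a))))

      decompose : ∀ i → c i ≡ (x +ᵥ combination us d) i
      decompose i with i ∈ᶠ? us
      ... | no i∉us = sym (trans (cong₂ ℚ._+_ (agree Subset.∈⊤ i∉us) (combination-∉ us d i∉us))
                                 (ℚₚ.+-identityʳ (c i)))
      ... | yes i∈us = subst (λ l → c l ≡ (x +ᵥ combination us d) l) (sym (lookup-index i∈us))
        (trans (cancel (c l) (x l))
          (cong (x l ℚ.+_) (sym (combination-lookup us d (unique basis) (index i∈us)))))
        where l = lookup us (index i∈us)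

  module _ {W : Subset n} {x : Vector ℚ n} (supported : ∀ {i} → i ∉ˢ W → x i ≡ 0ℚ) where

    supported-zero : ∀ {i} → (∀ j → j ∈ˢ W → A i j ≡ 0ℚ) → (A *ᵥ x) i ≡ 0ℚ
    supported-zero {i} zeros = ∑-zero _ term
      where
      term : ∀ j → A i j ℚ.* x j ≡ 0ℚ
      term j with j Subset.∈? W
      ... | yes j∈W = 0*y≡0 (x j) (zeros j j∈W)
      ... | no  j∉W = x*0≡0 (A i j) (supported j∉W)

    supported-single : ∀ {i a} → (∀ j → j ∈ˢ W → j ≢ a → A i j ≡ 0ℚ) → (A *ᵥ x) i ≡ A i a ℚ.* x a
    supported-single {i} {a} zeros = ∑-single _ a term
      where
      term : ∀ j → j ≢ a → A i j ℚ.* x j ≡ 0ℚ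
      term j j≢a with j Subset.∈? W
      ... | yes j∈W = 0*y≡0 (x j) (zeros j j∈W j≢a)
      ... | no  j∉W = x*0≡0 (A i j) (supported j∉W)

    supported-pair : ∀ {i a b} → a ≢ b → (∀ j → j ∈ˢ W → j ≢ a → j ≢ b → A i j ≡ 0ℚ) →
      (A *ᵥ x) i ≡ A i a ℚ.* x a ℚ.+ A i b ℚ.* x b
    supported-pair {i} {a} {b} a≢b zeros = ∑-pair _ a≢b term
      where
      term : ∀ j → j ≢ a → j ≢ b → A i j ℚ.* x j ≡ 0ℚ
      term j j≢a j≢b with j Subset.∈? W
      ... | yes j∈W = 0*y≡0 (x j) (zeros j j∈W j≢a j≢b)
      ... | no  j∉W = x*0≡0 (A i j) (supported j∉W)

  ∉-remove : ∀ {W : Subset n} {i u} → i ≢ u → i ∉ˢ W - u → i ∉ˢ W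
  ∉-remove i≢u i∉ i∈W = i∉ (Subset.x∈p∧x≢y⇒x∈p-y i∈W i≢u)

  -- Row and column `u` vanish on `W`: no equation restricts the coordinate at `u`, and it enters no
  -- equation. So `u` becomes a free index and `us` stays the same.
  isolated-columnBasis : ∀ {W u us} → (∀ j → j ∈ˢ W → A u j ≡ 0ℚ) → (∀ j → j ∈ˢ W → A j u ≡ 0ℚ) →
    u ∈ˢ W → ColumnBasis A (W - u) us → ColumnBasis A W us
  isolated-columnBasis {W} {u} {us} row col u∈W basis = record
    { unique  = unique basis
    ; members = x∈p-y⇒x∈p ∘ members basis
    ; extend  = ext
    ; trivial = λ ker zeros → trivial basis (restrict ker zeros) zeros
    }
    where
    u∉us : u ∉ us
    u∉us u∈us = x∈p-y⇒x≢y (members basis u∈us) refl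

    restrict : ∀ {x} → Kernel A W x → (∀ {i} → i ∉ us → x i ≡ 0ℚ) → Kernel A (W - u) x
    restrict {x} ker zeros = record { support = supp ; vanish = vanish ker ∘ x∈p-y⇒x∈p }
      where
      supp : ∀ {i} → i ∉ˢ W - u → x i ≡ 0ℚ
      supp {i} i∉ with i ≟ᶠ u
      ... | yes refl = zeros u∉us
      ... | no i≢u   = support ker (∉-remove i≢u i∉)

    ext : ∀ f → ∃[ x ] Kernel A W x × (∀ {i} → i ∈ˢ W → i ∉ us → x i ≡ f i)
    ext f with extend basis f
    ... | x , ker , agree = y , record { support = supp ; vanish = van } , agree′
      where
      y = x +ᵥ single u (f u)

      yu : y u ≡ f u
      yu = +-single-≡ x u (f u) (support ker λ u∈ → x∈p-y⇒x≢y u∈ refl)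

      supp : ∀ {i} → i ∉ˢ W → y i ≡ 0ℚ
      supp {i} i∉W = trans (+-single-≢ x (f u) λ { refl → i∉W u∈W }) (support ker (i∉W ∘ x∈p-y⇒x∈p))

      van : ∀ {i} → i ∈ˢ W → (A *ᵥ y) i ≡ 0ℚ
      van {i} i∈W with i ≟ᶠ u
      ... | yes refl = supported-zero supp row
      ... | no i≢u   = trans (*ᵥ-+-single A x u (f u) i)
        (cong₂ ℚ._+_ (vanish ker (Subset.x∈p∧x≢y⇒x∈p-y i∈W i≢u)) (0*y≡0 (f u) (col i i∈W)))

      agree′ : ∀ {i} → i ∈ˢ W → i ∉ us → y i ≡ f i
      agree′ {i} i∈W i∉us with i ≟ᶠ u
      ... | yes refl = yu
      ... | no i≢u   = trans (+-single-≢ x (f u) i≢u) (agree (Subset.x∈p∧x≢y⇒x∈p-y i∈W i≢u) i∉us)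

  -- Row `u` forces the coordinate at `v` to be 0. The coordinate at `u` occurs in row `v` alone,
  -- and that row determines it from the others. So both coordinates are determined, and what
  -- remains is a kernel vector on `W - u - v`.
  pendant-columnBasis : ∀ {W u v us} → u ≢ v → u ∈ˢ W → v ∈ˢ W →
    A u v ℚ.* A u v ≡ 1ℚ → A v u ℚ.* A v u ≡ 1ℚ →
    (∀ j → j ∈ˢ W → j ≢ v → A u j ≡ 0ℚ) → (∀ j → j ∈ˢ W → j ≢ v → A j u ≡ 0ℚ) →
    ColumnBasis A (W - u - v) us → ColumnBasis A W (u ∷ v ∷ us)
  pendant-columnBasis {W} {u} {v} {us} u≢v u∈W v∈W uv² vu² row col basis = record
    { unique  = ∉∷-unique (λ { (here u≡v) → u≢v u≡v ; (there u∈us) → u∉W′ (members basis u∈us) })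
                  (∉∷-unique (v∉W′ ∘ members basis) (unique basis))
    ; members = λ { (here refl) → u∈W ; (there (here refl)) → v∈W
                  ; (there (there i∈us)) → W′⊆W (members basis i∈us) }
    ; extend  = ext
    ; trivial = triv
    }
    where
    W′ = W - u - v

    W′⊆W : ∀ {i} → i ∈ˢ W′ → i ∈ˢ W
    W′⊆W = x∈p-y⇒x∈p ∘ x∈p-y⇒x∈p

    u∉W′ : u ∉ˢ W′
    u∉W′ u∈ = x∈p-y⇒x≢y (x∈p-y⇒x∈p u∈) refl

    v∉W′ : v ∉ˢ W′
    v∉W′ v∈ = x∈p-y⇒x≢y v∈ refl

    W′⁺ : ∀ {i} → i ∈ˢ W → i ≢ u → i ≢ v → i ∈ˢ W′
    W′⁺ i∈W i≢u i≢v = Subset.x∈p∧x≢y⇒x∈p-y (Subset.x∈p∧x≢y⇒x∈p-y i∈W i≢u) i≢v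

    ext : ∀ f → ∃[ y ] Kernel A W y × (∀ {i} → i ∈ˢ W → i ∉ u ∷ v ∷ us → y i ≡ f i)
    ext f with extend basis f
    ... | x , ker , agree = y , record { support = supp ; vanish = van } ,
        λ i∈W i∉ → trans (+-single-≢ x t (i∉ ∘ here))
          (agree (W′⁺ i∈W (i∉ ∘ here) (i∉ ∘ there ∘ here)) (i∉ ∘ there ∘ there))
      where
      -- Row `v` solved for the coordinate at `u`, the entry `A v u` being its own inverse.
      t = ℚ.- (A v u ℚ.* (A *ᵥ x) v)
      y = x +ᵥ single u t

      supp : ∀ {i} → i ∉ˢ W → y i ≡ 0ℚ
      supp i∉W = trans (+-single-≢ x t λ { refl → i∉W u∈W }) (support ker (i∉W ∘ W′⊆W))

      van : ∀ {i} → i ∈ˢ W → (A *ᵥ y) i ≡ 0ℚ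
      van {i} i∈W with i ≟ᶠ u | i ≟ᶠ v
      ... | yes refl | _ = trans (supported-single supp row)
        (x*0≡0 (A i v) (trans (+-single-≢ x t (u≢v ∘ sym)) (support ker v∉W′)))
      ... | no _ | yes refl = begin
        (A *ᵥ y) v                     ≡⟨ *ᵥ-+-single A x u t v ⟩
        (A *ᵥ x) v ℚ.+ A v u ℚ.* t
          ≡⟨ cong ((A *ᵥ x) v ℚ.+_) (sym (ℚₚ.neg-distribʳ-* (A v u) (A v u ℚ.* (A *ᵥ x) v))) ⟩
        (A *ᵥ x) v ℚ.- (A v u ℚ.* (A v u ℚ.* (A *ᵥ x) v))
          ≡⟨ cong (ℚ._-_ ((A *ᵥ x) v)) (involution-cancelˡ (A v u) _ vu²) ⟩
        (A *ᵥ x) v ℚ.- (A *ᵥ x) v      ≡⟨ ℚₚ.+-inverseʳ ((A *ᵥ x) v) ⟩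
        0ℚ                             ∎
        where open ≡-Reasoning
      ... | no i≢u | no i≢v = trans (*ᵥ-+-single A x u t i)
        (cong₂ ℚ._+_ (vanish ker (W′⁺ i∈W i≢u i≢v)) (0*y≡0 t (col i i∈W i≢v)))

    triv : ∀ {x} → Kernel A W x → (∀ {i} → i ∉ u ∷ v ∷ us → x i ≡ 0ℚ) → ∀ i → x i ≡ 0ℚ
    triv {x} ker zeros = all-zero
      where
      xv≡0 : x v ≡ 0ℚ
      xv≡0 = involution-zero (A u v) (x v) uv²
        (trans (sym (supported-single (support ker) row)) (vanish ker u∈W))

      -- Clearing the coordinate at `u` makes the support fit into `W′`, and it disturbs only the
      -- equation of row `v`, which is not among those for `W′`.
      y = x +ᵥ single u (ℚ.- x u)

      yu≡0 : y u ≡ 0ℚ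
      yu≡0 = trans (cong (x u ℚ.+_) (single-≡ u _)) (ℚₚ.+-inverseʳ (x u))

      y≡x : ∀ {i} → i ≢ u → y i ≡ x i
      y≡x = +-single-≢ x (ℚ.- x u)

      supp : ∀ {i} → i ∉ˢ W′ → y i ≡ 0ℚ
      supp {i} i∉W′ with i ≟ᶠ u | i ≟ᶠ v
      ... | yes refl | _        = yu≡0
      ... | no i≢u   | yes refl = trans (y≡x i≢u) xv≡0
      ... | no i≢u   | no i≢v   = trans (y≡x i≢u) (support ker λ i∈W → i∉W′ (W′⁺ i∈W i≢u i≢v))

      y-zeros : ∀ {i} → i ∉ us → y i ≡ 0ℚ
      y-zeros {i} i∉us with i ≟ᶠ u | i ≟ᶠ v
      ... | yes refl | _        = yu≡0
      ... | no i≢u   | yes refl = trans (y≡x i≢u) xv≡0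
      ... | no i≢u   | no i≢v   = trans (y≡x i≢u)
        (zeros λ { (here e) → i≢u e ; (there (here e)) → i≢v e ; (there (there i∈)) → i∉us i∈ })

      y≡0 : ∀ i → y i ≡ 0ℚ
      y≡0 = trivial basis (record
        { support = supp
        ; vanish  = λ {i} i∈W′ → trans (*ᵥ-+-single A x u (ℚ.- x u) i)
            (cong₂ ℚ._+_ (vanish ker (W′⊆W i∈W′))
              (0*y≡0 (ℚ.- x u) (col i (W′⊆W i∈W′) (x∈p-y⇒x≢y i∈W′))))
        }) y-zeros

      x≡0 : ∀ i → i ≢ u → x i ≡ 0ℚ
      x≡0 i i≢u = trans (sym (y≡x i≢u)) (y≡0 i)

      -- All other coordinates being 0, row `v` has a single term left.
      xu≡0 : x u ≡ 0ℚ
      xu≡0 = involution-zero (A v u) (x u) vu²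
        (trans (sym (∑-single (λ j → A v j ℚ.* x j) u λ j j≢u → x*0≡0 (A v j) (x≡0 j j≢u))) (vanish ker v∈W))

      all-zero : ∀ i → x i ≡ 0ℚ
      all-zero i with i ≟ᶠ u
      ... | yes refl = xu≡0
      ... | no i≢u   = x≡0 i i≢u

-- Adjacency, arcs and the entries of the skew-adjacency matrix

module _ {n} (G : OrientedGraph n) where

  open OrientedGraph G hiding (Adjacent)

  adjacent-sym : ∀ {x y} → Adjacent G x y → Adjacent G y x
  adjacent-sym = SymClosure.symmetric Arc

  adjacent-irrefl : ∀ {x y} → Adjacent G x y → x ≢ y
  adjacent-irrefl (fwd xy) refl = asym xy xy
  adjacent-irrefl (bwd yx) refl = asym yx yx

  adjacent? : ∀ x y → Dec (Adjacent G x y)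
  adjacent? x y with arc? x y | arc? y x
  ... | yes xy | _      = yes (fwd xy)
  ... | no _   | yes yx = yes (bwd yx)
  ... | no ¬xy | no ¬yx = no λ { (fwd xy) → ¬xy xy ; (bwd yx) → ¬yx yx }

  orient : ∀ {x y} → Adjacent G x y → Edge n
  orient {x} {y} (fwd _) = x , y
  orient {x} {y} (bwd _) = y , x

  orient-arc : ∀ {x y} (xy : Adjacent G x y) → Arc (proj₁ (orient xy)) (proj₂ (orient xy))
  orient-arc (fwd xy) = xy
  orient-arc (bwd yx) = yx

  orient-left : ∀ {x y} (xy : Adjacent G x y) → Incident x (orient xy)
  orient-left (fwd _) = inj₁ refl
  orient-left (bwd _) = inj₂ refl

  orient-right : ∀ {x y} (xy : Adjacent G x y) → Incident y (orient xy)
  orient-right (fwd _) = inj₂ refl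
  orient-right (bwd _) = inj₁ refl

  orient-incident : ∀ {x y z} (xy : Adjacent G x y) → Incident z (orient xy) → z ≡ x ⊎ z ≡ y
  orient-incident (fwd _) = id
  orient-incident (bwd _) = swap

  -- Asymmetry excludes loops and the reversed pair, so two adjacent vertices have only one
  -- representation as an edge.
  arc-orient : ∀ {a b x y} → Arc a b → (xy : Adjacent G x y) →
    Incident x (a , b) → Incident y (a , b) → (a , b) ≡ orient xy
  arc-orient ab (fwd xy) (inj₁ refl) (inj₁ refl) = contradiction xy (asym xy)
  arc-orient ab (fwd xy) (inj₁ refl) (inj₂ refl) = refl
  arc-orient ab (fwd xy) (inj₂ refl) (inj₁ refl) = contradiction xy (asym ab)
  arc-orient ab (fwd xy) (inj₂ refl) (inj₂ refl) = contradiction xy (asym xy)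
  arc-orient ab (bwd yx) (inj₁ refl) (inj₁ refl) = contradiction yx (asym yx)
  arc-orient ab (bwd yx) (inj₁ refl) (inj₂ refl) = contradiction yx (asym ab)
  arc-orient ab (bwd yx) (inj₂ refl) (inj₁ refl) = refl
  arc-orient ab (bwd yx) (inj₂ refl) (inj₂ refl) = contradiction yx (asym yx)

  skew-arc : ∀ {x y} → Arc x y → skewAdjacency G x y ≡ 1ℚ
  skew-arc {x} {y} xy rewrite dec-true (arc? x y) xy = refl

  skew-arc⁻ : ∀ {x y} → Arc y x → skewAdjacency G x y ≡ ℚ.- 1ℚ
  skew-arc⁻ {x} {y} yx rewrite dec-false (arc? x y) (asym yx) | dec-true (arc? y x) yx = refl

  skew-¬adjacent : ∀ {x y} → ¬ Adjacent G x y → skewAdjacency G x y ≡ 0ℚ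
  skew-¬adjacent {x} {y} ¬xy
    rewrite dec-false (arc? x y) (¬xy ∘ fwd) | dec-false (arc? y x) (¬xy ∘ bwd) = refl

  skew-antisym : ∀ x y → skewAdjacency G y x ≡ ℚ.- skewAdjacency G x y
  skew-antisym x y with adjacent? x y
  ... | yes (fwd xy) = trans (skew-arc⁻ xy) (cong ℚ.-_ (sym (skew-arc xy)))
  ... | yes (bwd yx) = trans (skew-arc yx) (cong ℚ.-_ (sym (skew-arc⁻ yx)))
  ... | no ¬xy = trans (skew-¬adjacent (¬xy ∘ adjacent-sym)) (cong ℚ.-_ (sym (skew-¬adjacent ¬xy)))

  skew-square : ∀ {x y} → Adjacent G x y → skewAdjacency G x y ℚ.* skewAdjacency G x y ≡ 1ℚ
  skew-square (fwd xy) = cong₂ ℚ._*_ (skew-arc xy) (skew-arc xy)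
  skew-square (bwd yx) = cong₂ ℚ._*_ (skew-arc⁻ yx) (skew-arc⁻ yx)

-- The reduction by isolated and pendant vertices

module _ {n} (G : OrientedGraph n) where

  record Pendant (W : Subset n) (u v : Fin n) : Set where
    field
      u∈W  : u ∈ˢ W
      v∈W  : v ∈ˢ W
      edge : Adjacent G u v
      only : ∀ {x} → x ∈ˢ W → Adjacent G u x → x ≡ v

  -- The number counts pendant steps only: each is worth 2 in the rank and 1 in the matching number,
  -- while isolated vertices change neither. The end `T` is arbitrary so that both possible ends
  -- share the invariance lemmas.
  data Elimination (T : Subset n) : Subset n → ℕ → Set where
    stop     : Elimination T T 0
    isolated : ∀ {W u p} → u ∈ˢ W → (∀ {x} → x ∈ˢ W → ¬ Adjacent G u x) →
               Elimination T (W - u) p → Elimination T W p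
    pendant  : ∀ {W u v p} → Pendant W u v → Elimination T (W - u - v) p → Elimination T W (suc p)

open Pendant

module _ {n} {G : OrientedGraph n} where

  eliminate-columnBasis : ∀ {T W p us} → Elimination G T W p → ColumnBasis (skewAdjacency G) T us →
    ∃[ vs ] length vs ≡ 2 * p + length us × ColumnBasis (skewAdjacency G) W vs
  eliminate-columnBasis stop basis = _ , refl , basis
  eliminate-columnBasis (isolated u∈W alone el) basis with eliminate-columnBasis el basis
  ... | vs , len , basis′ = vs , len , isolated-columnBasis
    (λ _ j∈W → skew-¬adjacent G (alone j∈W))
    (λ _ j∈W → skew-¬adjacent G (alone j∈W ∘ adjacent-sym G)) u∈W basis′
  eliminate-columnBasis {us = us} (pendant {u = u} {v} {p} pen el) basis with eliminate-columnBasis el basis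
  ... | vs , len , basis′ = u ∷ v ∷ vs ,
    trans (cong (2 +_) len) (cong (_+ length us) (sym (ℕₚ.*-suc 2 p))) ,
    pendant-columnBasis (adjacent-irrefl G (edge pen)) (u∈W pen) (v∈W pen)
      (skew-square G (edge pen)) (skew-square G (adjacent-sym G (edge pen)))
      (λ _ j∈W j≢v → skew-¬adjacent G (j≢v ∘ only pen j∈W))
      (λ _ j∈W j≢v → skew-¬adjacent G (j≢v ∘ only pen j∈W ∘ adjacent-sym G)) basis′

  matching-mono : ∀ {V W M} → V ⊆ˢ W → Matching G V M → Matching G W M
  matching-mono V⊆W isM = record
    { arc = arc isM ; within = λ e∈ xe → V⊆W (within isM e∈ xe) ; meet = meet isM ; unique = unique isM }

  isolated-matching : ∀ {W u M} → (∀ {x} → x ∈ˢ W → ¬ Adjacent G u x) →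
    Matching G W M → Matching G (W - u) M
  isolated-matching {W} {u} {M} alone isM = record
    { arc = arc isM ; within = inside-W ; meet = meet isM ; unique = unique isM }
    where
    inside-W : ∀ {e x} → e ∈ M → Incident x e → x ∈ˢ W - u
    inside-W e∈ xe = Subset.x∈p∧x≢y⇒x∈p-y (within isM e∈ xe) λ { refl → case xe of λ
      { (inj₁ refl) → alone (within isM e∈ (inj₂ refl)) (fwd (arc isM e∈))
      ; (inj₂ refl) → alone (within isM e∈ (inj₁ refl)) (bwd (arc isM e∈)) } }

  module _ {W : Subset n} {u v : Fin n} (pen : Pendant G W u v) where

    avoiding : List (Edge n) → List (Edge n)
    avoiding = filter (λ e → ¬? (incident? v e))

    avoiding-⊆ : ∀ {M} → avoiding M ⊆ M
    avoiding-⊆ {M} e∈ = proj₁ (∈-filter⁻ (λ e → ¬? (incident? v e)) {xs = M} e∈)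

    -- Within `W` every edge at `u` also contains `v`, so discarding the edges at `v` clears both
    -- vertices.
    avoiding-matching : ∀ {M} → Matching G W M → Matching G (W - u - v) (avoiding M)
    avoiding-matching {M} isM = record
      { arc    = arc isM ∘ avoiding-⊆
      ; within = inside-W
      ; meet   = λ e∈ f∈ → meet isM (avoiding-⊆ e∈) (avoiding-⊆ f∈)
      ; unique = Unique.filter⁺ (λ e → ¬? (incident? v e)) (unique isM)
      }
      where
      inside-W : ∀ {e x} → e ∈ avoiding M → Incident x e → x ∈ˢ W - u - v
      inside-W {a , b} e∈ xe with ∈-filter⁻ (λ e → ¬? (incident? v e)) {xs = M} e∈
      ... | e∈M , ¬ve = Subset.x∈p∧x≢y⇒x∈p-y
        (Subset.x∈p∧x≢y⇒x∈p-y (within isM e∈M xe) λ { refl → case xe of λ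
          { (inj₁ refl) → ¬ve (inj₂ (sym (only pen (within isM e∈M (inj₂ refl)) (fwd (arc isM e∈M)))))
          ; (inj₂ refl) → ¬ve (inj₁ (sym (only pen (within isM e∈M (inj₁ refl)) (bwd (arc isM e∈M)))))
          } })
        λ { refl → ¬ve xe }

    -- Two edges at `v` would meet there, so at most one edge is discarded.
    avoiding-length : ∀ {M} → Matching G W M → length M ≤ suc (length (avoiding M))
    avoiding-length {M} isM with All.all? (λ e → ¬? (incident? v e)) M
    ... | yes none = ℕₚ.m≤n⇒m≤1+n (Unique⊆⇒length≤ (unique isM) λ e∈ →
      ∈-filter⁺ (λ e → ¬? (incident? v e)) e∈ (All.lookup none e∈))
    ... | no some with find (¬All⇒Any¬ (λ e → ¬? (incident? v e)) M some)
    ...   | f , f∈M , ¬¬vf = Unique⊆⇒length≤ (unique isM) sub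
      where
      vf = decidable-stable (incident? v f) ¬¬vf
      sub : M ⊆ f ∷ avoiding M
      sub {e} e∈M with incident? v e
      ... | yes ve = here (meet isM e∈M f∈M ve vf)
      ... | no ¬ve = there (∈-filter⁺ (λ e → ¬? (incident? v e)) e∈M ¬ve)

    e₀ : Edge n
    e₀ = orient G (edge pen)

    e₀-avoids : ∀ {x} → x ∈ˢ W - u - v → ¬ Incident x e₀
    e₀-avoids x∈ xe with orient-incident G (edge pen) xe
    ... | inj₁ x≡u = x∈p-y⇒x≢y (x∈p-y⇒x∈p x∈) x≡u
    ... | inj₂ x≡v = x∈p-y⇒x≢y x∈ x≡v

    extend-matching : ∀ {M} → Matching G (W - u - v) M → Matching G W (e₀ ∷ M)
    extend-matching {M} isM = record
      { arc    = λ { (here refl) → orient-arc G (edge pen) ; (there e∈) → arc isM e∈ }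
      ; within = λ
        { (here refl) xe → case orient-incident G (edge pen) xe of λ
            { (inj₁ refl) → u∈W pen ; (inj₂ refl) → v∈W pen }
        ; (there e∈) xe → x∈p-y⇒x∈p (x∈p-y⇒x∈p (within isM e∈ xe)) }
      ; meet   = λ
        { (here refl) (here refl) _ _ → refl
        ; (here refl) (there f∈) xe xf → contradiction xe (e₀-avoids (within isM f∈ xf))
        ; (there e∈) (here refl) xe xf → contradiction xf (e₀-avoids (within isM e∈ xe))
        ; (there e∈) (there f∈) xe xf → meet isM e∈ f∈ xe xf }
      ; unique = ∉∷-unique
          (λ e₀∈M → e₀-avoids (within isM e₀∈M (orient-left G (edge pen))) (orient-left G (edge pen)))
          (unique isM)
      }

    -- Adding `e₀` gains one edge and `avoiding` loses at most one. So the two maxima differ by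
    -- exactly one, and both operations preserve maximality.
    extend-maximum : ∀ {M} → MaximumMatching G (W - u - v) M → MaximumMatching G W (e₀ ∷ M)
    extend-maximum isMax = record
      { matching = extend-matching (matching isMax)
      ; maximum  = λ isN → ℕₚ.≤-trans (avoiding-length isN)
          (s≤s (maximum isMax (avoiding-matching isN)))
      }

    avoiding-maximum : ∀ {M} → MaximumMatching G W M → MaximumMatching G (W - u - v) (avoiding M)
    avoiding-maximum isMax = record
      { matching = avoiding-matching (matching isMax)
      ; maximum  = λ isN → ℕₚ.≤-pred (ℕₚ.≤-trans (maximum isMax (extend-matching isN))
          (avoiding-length (matching isMax)))
      }

  isolated-maximum⁺ : ∀ {W u M} → (∀ {x} → x ∈ˢ W → ¬ Adjacent G u x) →
    MaximumMatching G (W - u) M → MaximumMatching G W M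
  isolated-maximum⁺ alone isMax = record
    { matching = matching-mono x∈p-y⇒x∈p (matching isMax)
    ; maximum  = maximum isMax ∘ isolated-matching alone
    }

  isolated-maximum⁻ : ∀ {W u M} → (∀ {x} → x ∈ˢ W → ¬ Adjacent G u x) →
    MaximumMatching G W M → MaximumMatching G (W - u) M
  isolated-maximum⁻ alone isMax = record
    { matching = isolated-matching alone (matching isMax)
    ; maximum  = maximum isMax ∘ matching-mono x∈p-y⇒x∈p
    }

  ∅-maximum : MaximumMatching G ∅ []
  ∅-maximum = record
    { matching = []-matching
    ; maximum  = λ { {[]} _ → z≤n
                   ; {_ ∷ _} isN → contradiction (within isN (here refl) (inj₁ refl)) Subset.∉⊥ }
    }

  eliminate-maximum : ∀ {T W p M} → Elimination G T W p → MaximumMatching G T M →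
    ∃[ N ] length N ≡ p + length M × MaximumMatching G W N
  eliminate-maximum stop isMax = _ , refl , isMax
  eliminate-maximum (isolated u∈W alone el) isMax with eliminate-maximum el isMax
  ... | N , len , isMax′ = N , len , isolated-maximum⁺ alone isMax′
  eliminate-maximum (pendant pen el) isMax with eliminate-maximum el isMax
  ... | N , len , isMax′ = e₀ pen ∷ N , cong suc len , extend-maximum pen isMax′

  -- In contrast to `eliminate-maximum`, the given matching is an arbitrary maximum one of the
  -- larger set, as a claim about all of them requires. The inclusion `N ⊆ M` carries what `N` does
  -- on `T` back to `M`.
  eliminate-restrict : ∀ {T W p M} → Elimination G T W p → MaximumMatching G W M →
    ∃[ N ] N ⊆ M × MaximumMatching G T N
  eliminate-restrict stop isMax = _ , id , isMax
  eliminate-restrict (isolated u∈W alone el) isMax =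
    eliminate-restrict el (isolated-maximum⁻ alone isMax)
  eliminate-restrict (pendant pen el) isMax with eliminate-restrict el (avoiding-maximum pen isMax)
  ... | N , N⊆ , isMax′ = N , avoiding-⊆ pen ∘ N⊆ , isMax′

-- Non-backtracking walks and the unique cycle

module _ {n} {G : OrientedGraph n} where

  next-suc : ∀ {l} (i : Fin l) → suc (toℕ i) < l → toℕ (next i) ≡ suc (toℕ i)
  next-suc {suc l} i i+1<l = trans (toℕ-fromℕ< _) (m<n⇒m%n≡m i+1<l)

  next-last : ∀ {l} (i : Fin l) → suc (toℕ i) ≡ l → toℕ (next i) ≡ 0
  next-last {suc l} i i+1≡l =
    trans (toℕ-fromℕ< _) (trans (cong (_% suc l) i+1≡l) (n%n≡0 (suc l)))

  sequence⇒cycle : ∀ {l} → 3 ≤ l → (w : ℕ → Fin n) → (∀ {i j} → i < j → j < l → w i ≢ w j) →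
    (∀ i → suc i < l → Adjacent G (w i) (w (suc i))) →
    (∀ i → suc i ≡ l → Adjacent G (w i) (w 0)) → Cycle G l
  sequence⇒cycle {l} 3≤l w distinct step close = record
    { 3≤k       = 3≤l
    ; vertex    = w ∘ toℕ
    ; injective = λ {i} {j} eq → toℕ-injective (inj i j eq)
    ; adjacent  = adj
    }
    where
    inj : ∀ (i j : Fin l) → w (toℕ i) ≡ w (toℕ j) → toℕ i ≡ toℕ j
    inj i j eq with ℕₚ.<-cmp (toℕ i) (toℕ j)
    ... | tri< i<j _ _ = contradiction eq (distinct i<j (toℕ<n j))
    ... | tri≈ _ i≡j _ = i≡j
    ... | tri> _ _ j<i = contradiction (sym eq) (distinct j<i (toℕ<n i))

    adj : ∀ i → Adjacent G (w (toℕ i)) (w (toℕ (next i)))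
    adj i with ℕₚ.m≤n⇒m<n∨m≡n (toℕ<n i)
    ... | inj₁ i+1<l = subst (Adjacent G (w (toℕ i)) ∘ w) (sym (next-suc i i+1<l)) (step (toℕ i) i+1<l)
    ... | inj₂ i+1≡l = subst (Adjacent G (w (toℕ i)) ∘ w) (sym (next-last i i+1≡l)) (close (toℕ i) i+1≡l)

  -- `distinct` includes the indices before `start`. The period alone would close a cycle; the
  -- initial segment is what shows that `w 0` is off this cycle unless `start` is 0.
  record FirstRepetition (w : ℕ → Fin n) : Set where
    field
      start period : ℕ
      0<period     : 0 < period
      repeats      : w (start + period) ≡ w start
      distinct     : ∀ {i j} → i < j → j < start + period → w i ≢ w j

  open FirstRepetition

  firstRepetition : ∀ w → FirstRepetition w
  firstRepetition w with search (suc n)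
    where
    search : ∀ N → FirstRepetition w ⊎ (∀ {i j} → i < j → j < N → w i ≢ w j)
    search zero = inj₂ λ _ ()
    search (suc N) with search N
    ... | inj₁ rep = inj₁ rep
    ... | inj₂ dist with ℕₚ.anyUpTo? (λ i → w i ≟ᶠ w N) N
    ...   | yes (i , i<N , eq) = inj₁ record
      { start    = i
      ; period   = N ∸ i
      ; 0<period = ℕₚ.m<n⇒0<n∸m i<N
      ; repeats  = trans (cong w i+p) (sym eq)
      ; distinct = λ a<b b<N → dist a<b (subst (_ <_) i+p b<N)
      }
      where
      i+p : i + (N ∸ i) ≡ N
      i+p = ℕₚ.m+[n∸m]≡n (ℕₚ.<⇒≤ i<N)
    ...   | no none = inj₂ extend-distinct
      where
      extend-distinct : ∀ {i j} → i < j → j < suc N → w i ≢ w j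
      extend-distinct i<j (s≤s j≤N) eq with ℕₚ.m≤n⇒m<n∨m≡n j≤N
      ... | inj₁ j<N  = dist i<j j<N eq
      ... | inj₂ refl = none (_ , i<j , eq)
  ... | inj₁ rep  = rep
  ... | inj₂ dist with pigeonhole (ℕₚ.n<1+n n) (w ∘ toℕ)
  ...   | i , j , i<j , eq = contradiction eq (dist i<j (toℕ<n j))

  record NonBacktracking (W : Subset n) (w : ℕ → Fin n) : Set where
    field
      stays  : ∀ i → w i ∈ˢ W
      steps  : ∀ i → Adjacent G (w i) (w (suc i))
      onward : ∀ i → w (2 + i) ≢ w i

  open NonBacktracking

  module _ {W w} (walk : NonBacktracking W w) (rep : FirstRepetition w) where

    -- Period 1 would be a loop and period 2 a step back.
    3≤period : 3 ≤ period rep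
    3≤period = go (period rep) (0<period rep) (repeats rep)
      where
      s = start rep
      go : ∀ p → 0 < p → w (s + p) ≡ w s → 3 ≤ p
      go 1 _ eq = contradiction (sym (trans (sym (cong w (ℕₚ.+-comm s 1))) eq))
        (adjacent-irrefl G (steps walk s))
      go 2 _ eq = contradiction (trans (sym (cong w (ℕₚ.+-comm s 2))) eq) (onward walk s)
      go (suc (suc (suc p))) _ _ = s≤s (s≤s (s≤s z≤n))

    walkCycle : Cycle G (period rep)
    walkCycle = sequence⇒cycle 3≤period (λ t → w (start rep + t))
      (λ i<j j<p → distinct rep (ℕₚ.+-monoʳ-< (start rep) i<j) (ℕₚ.+-monoʳ-< (start rep) j<p))
      (λ i _ → step i)
      (λ i i+1≡p → subst (Adjacent G (w (start rep + i)))
        (trans (cong (λ t → w (start rep + t)) i+1≡p)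
          (trans (repeats rep) (cong w (sym (ℕₚ.+-identityʳ (start rep)))))) (step i))
      where
      step : ∀ i → Adjacent G (w (start rep + i)) (w (start rep + suc i))
      step i = subst (Adjacent G (w (start rep + i))) (cong w (sym (ℕₚ.+-suc (start rep) i)))
        (steps walk (start rep + i))

  -- Minimum degree at least 2 in the subgraph on `W`, in the form in which a walk uses it: one
  -- vertex `p`, the one just left, can always be avoided.
  Branching : Subset n → Set
  Branching W = ∀ p {u} → u ∈ˢ W → ∃[ v ] v ∈ˢ W × Adjacent G u v × v ≢ p

  module _ {W} (branching : Branching W) where

    module WalkFrom {p u} (p∈W : p ∈ˢ W) (u∈W : u ∈ˢ W) (pu : Adjacent G p u) where

      -- A state is a step rather than a vertex, since the next choice depends on the vertex just
      -- left.
      state : ℕ → Σ[ (a , b) ∈ Fin n × Fin n ] a ∈ˢ W × b ∈ˢ W × Adjacent G a b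
      state zero = (p , u) , p∈W , u∈W , pu
      state (suc i) with state i
      ... | (a , b) , _ , b∈W , _ with branching a b∈W
      ...   | c , c∈W , bc , _ = (b , c) , b∈W , c∈W , bc

      position : ℕ → Fin n
      position i = proj₁ (proj₁ (state i))

      position-suc : ∀ i → position (suc i) ≡ proj₂ (proj₁ (state i))
      position-suc i with state i
      ... | (a , b) , _ , b∈W , _ with branching a b∈W
      ...   | c , c∈W , bc , _ = refl

      state-onward : ∀ i → proj₂ (proj₁ (state (suc i))) ≢ position i
      state-onward i with state i
      ... | (a , b) , _ , b∈W , _ with branching a b∈W
      ...   | c , c∈W , bc , c≢a = c≢a

      walkFrom : NonBacktracking W position
      walkFrom = record
        { stays  = λ i → proj₁ (proj₂ (state i))
        ; steps  = λ i → subst (Adjacent G (position i)) (sym (position-suc i))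
                           (proj₂ (proj₂ (proj₂ (state i))))
        ; onward = λ i eq → state-onward i (trans (sym (position-suc (suc i))) eq)
        }

    walkAt : ∀ {u} → u ∈ˢ W → ∃[ w ] w 0 ≡ u × NonBacktracking W w
    walkAt {u} u∈W with branching u u∈W
    ... | v , v∈W , uv , _ = position , refl , walkFrom
      where open WalkFrom u∈W v∈W uv

    walkAlong : ∀ {u v} → u ∈ˢ W → v ∈ˢ W → Adjacent G u v →
      ∃[ w ] w 0 ≡ u × w 1 ≡ v × NonBacktracking W w
    walkAlong u∈W v∈W uv = position , refl , position-suc 0 , walkFrom
      where open WalkFrom u∈W v∈W uv

  module _ {k} {C : Cycle G k} where

    ∈vertexSet⁺ : ∀ i → vertex C i ∈ˢ vertexSet C
    ∈vertexSet⁺ i = lookup⇒[]= (vertex C i) (vertexSet C)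
      (trans (lookup∘tabulate _ (vertex C i)) (dec-true (any? λ j → vertex C j ≟ᶠ vertex C i) (i , refl)))

    ∈vertexSet⁻ : ∀ {x} → x ∈ˢ vertexSet C → ∃[ i ] vertex C i ≡ x
    ∈vertexSet⁻ {x} x∈ with any? (λ i → vertex C i ≟ᶠ x)
                          | trans (sym (lookup∘tabulate (λ y → does (any? λ i → vertex C i ≟ᶠ y)) x)) ([]=⇒lookup x∈)
    ... | yes found | _  = found
    ... | no _      | ()

    module _ (uniq : IsUniqueCycle C) where

      vertex-of-cycle : ∀ {l} (D : Cycle G l) {x} → x ∈ˢ vertexSet C → ∃[ i ] x ≡ vertex D i
      vertex-of-cycle D x∈ with ∈vertexSet⁻ x∈
      ... | i , refl with Equivalence.from (uniq D (vertex C i) (vertex C (next i))) (i , inj₁ (refl , refl))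
      ...   | j , inj₁ (eq , _) = j , eq
      ...   | j , inj₂ (_ , eq) = next j , eq

      cycle-vertex : ∀ {l} (D : Cycle G l) i → vertex D i ∈ˢ vertexSet C
      cycle-vertex D i with Equivalence.to (uniq D (vertex D i) (vertex D (next i))) (i , inj₁ (refl , refl))
      ... | j , inj₁ (eq , _) = subst (_∈ˢ vertexSet C) (sym eq) (∈vertexSet⁺ j)
      ... | j , inj₂ (_ , eq) = subst (_∈ˢ vertexSet C) (sym eq) (∈vertexSet⁺ (next j))

      module _ {W} (branching : Branching W) where

        -- A walk in `W` closes a cycle, whose vertices are visited by the walk; by uniqueness they
        -- include all vertices of `C`.
        branching⇒⊇ : ∀ {u} → u ∈ˢ W → vertexSet C ⊆ˢ W
        branching⇒⊇ u∈W x∈C with walkAt branching u∈W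
        ... | w , _ , walk with vertex-of-cycle (walkCycle walk (firstRepetition w)) x∈C
        ...   | i , refl = stays walk _

        -- A walk from W that enters the cycle C is reversed at the point of
        -- entry; the first cycle closed by the reversed walk cannot be C.
        branching⇒⊆ : W ⊆ˢ vertexSet C
        branching⇒⊆ {x} x∈W = decidable-stable (x Subset.∈? vertexSet C) outside-impossible
          where
          outside-impossible : x ∉ˢ vertexSet C → ⊥
          outside-impossible x∉C with walkAt branching x∈W
          ... | w , refl , walk = uncurry leave (entry (start rep + 0) on-C)
            where
            rep = firstRepetition w

            -- The cycle closed by the walk is `C`, so the walk, starting off `C`, has to enter it
            -- at some point.
            on-C : w (start rep + 0) ∈ˢ vertexSet C
            on-C = subst (λ t → w (start rep + t) ∈ˢ vertexSet C) (toℕ-fromℕ< (0<period rep))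
              (cycle-vertex (walkCycle walk rep) (fromℕ< (0<period rep)))

            entry : ∀ t → w t ∈ˢ vertexSet C → ∃[ s ] w s ∉ˢ vertexSet C × w (suc s) ∈ˢ vertexSet C
            entry zero    w0∈ = contradiction w0∈ x∉C
            entry (suc t) wt∈ with w t Subset.∈? vertexSet C
            ... | yes w∈ = entry t w∈
            ... | no w∉  = t , w∉ , wt∈

            leave : ∀ s → ¬ (w s ∉ˢ vertexSet C × w (suc s) ∈ˢ vertexSet C)
            leave s (ws∉ , ws+1∈)
              with walkAlong branching (stays walk (suc s)) (stays walk s) (adjacent-sym G (steps walk s))
            ... | z , z0 , z1 , walk′ = uncurry reach
              (vertex-of-cycle D (subst (_∈ˢ vertexSet C) (sym z0) ws+1∈))
              where
              rep′ = firstRepetition z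
              D = walkCycle walk′ rep′

              -- `z 0` is the point of entry and lies on `C`, hence on `D`. By distinctness it could
              -- only be the vertex where `D` starts, but the next vertex of `D` would then be
              -- `z 1`, which is off `C`.
              reach : ∀ i → z 0 ≢ vertex D i
              reach i eq with start rep′ + toℕ i in pos
              ... | suc t = distinct rep′ {0} {suc t} z<s
                (subst (_< start rep′ + period rep′) pos (ℕₚ.+-monoʳ-< (start rep′) (toℕ<n i))) eq
              ... | zero = ws∉ (subst (_∈ˢ vertexSet C) (trans (cong z start+1) z1)
                (cycle-vertex D one))
                where
                1<p : 1 < period rep′
                1<p = ℕₚ.<-≤-trans (s<s z<s) (3≤period walk′ rep′)
                one = fromℕ< 1<p
                start+1 : start rep′ + toℕ one ≡ 1
                start+1 = cong₂ _+_ (ℕₚ.m+n≡0⇒m≡0 (start rep′) pos) (toℕ-fromℕ< 1<p)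

        branching⇒≡ : ∀ {u} → u ∈ˢ W → W ≡ vertexSet C
        branching⇒≡ u∈W = Subset.⊆-antisym branching⇒⊆ (branching⇒⊇ u∈W)

  lowDegree? : ∀ W → (∃[ u ] u ∈ˢ W × (∀ {x} → x ∈ˢ W → ¬ Adjacent G u x)) ⊎
                     (∃₂ λ u v → Pendant G W u v) ⊎ Branching W
  lowDegree? W with any? (λ u → (u Subset.∈? W) ×-dec ¬? (any? λ x → (x Subset.∈? W) ×-dec adjacent? G u x))
  ... | yes (u , u∈W , alone) = inj₁ (u , u∈W , λ x∈W ux → alone (_ , x∈W , ux))
  ... | no ¬isolated with any? (λ u → any? λ v → (u Subset.∈? W) ×-dec (v Subset.∈? W) ×-dec
                            adjacent? G u v ×-dec
                            ¬? (any? λ x → (x Subset.∈? W) ×-dec adjacent? G u x ×-dec ¬? (x ≟ᶠ v)))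
  ...   | yes (u , v , u∈W , v∈W , uv , lone) = inj₂ (inj₁ (u , v , record
    { u∈W = u∈W ; v∈W = v∈W ; edge = uv
    ; only = λ {x} x∈W ux → decidable-stable (x ≟ᶠ v) λ x≢v → lone (x , x∈W , ux , x≢v) }))
  ...   | no ¬pendant = inj₂ (inj₂ branch)
    where
    branch : Branching W
    branch p {u} u∈W
      with any? (λ x → (x Subset.∈? W) ×-dec adjacent? G u x ×-dec ¬? (x ≟ᶠ p))
    ... | yes found = found
    ... | no none with any? (λ x → (x Subset.∈? W) ×-dec adjacent? G u x)
    ...   | no alone = contradiction (u , u∈W , alone) ¬isolated
    ...   | yes (v , v∈W , uv) = contradiction (u , v , u∈W , v∈W , uv , lone) ¬pendant
      where
      ≡p : ∀ {x} → x ∈ˢ W → Adjacent G u x → x ≡ p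
      ≡p {x} x∈W ux = decidable-stable (x ≟ᶠ p) λ x≢p → none (x , x∈W , ux , x≢p)
      lone : ¬ (∃[ x ] x ∈ˢ W × Adjacent G u x × x ≢ v)
      lone (x , x∈W , ux , x≢v) = x≢v (trans (≡p x∈W ux) (sym (≡p v∈W uv)))

  module _ {k} {C : Cycle G k} (uniq : IsUniqueCycle C) where

    Elimination-to-∅-or-C : Subset n → Set
    Elimination-to-∅-or-C W = ∃[ p ] (Elimination G ∅ W p ⊎ Elimination G (vertexSet C) W p)

    eliminate : ∀ W → Elimination-to-∅-or-C W
    eliminate W = go W (<-wellFounded ∣ W ∣)
      where
      go : ∀ W → Acc _<_ ∣ W ∣ → Elimination-to-∅-or-C W
      go W (acc rec) with lowDegree? W
      ... | inj₁ (u , u∈W , alone) with go (W - u) (rec (Subset.x∈p⇒∣p-x∣<∣p∣ u∈W))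
      ...   | p , inj₁ el = p , inj₁ (isolated u∈W alone el)
      ...   | p , inj₂ el = p , inj₂ (isolated u∈W alone el)
      go W (acc rec) | inj₂ (inj₁ (u , v , pen))
        with go (W - u - v) (rec (ℕₚ.<-trans
               (Subset.x∈p⇒∣p-x∣<∣p∣ (Subset.x∈p∧x≢y⇒x∈p-y (v∈W pen) (adjacent-irrefl G (edge pen) ∘ sym)))
               (Subset.x∈p⇒∣p-x∣<∣p∣ (u∈W pen))))
      ...   | p , inj₁ el = suc p , inj₁ (pendant pen el)
      ...   | p , inj₂ el = suc p , inj₂ (pendant pen el)
      go W (acc rec) | inj₂ (inj₂ branching) with Subset.nonempty? W
      ...   | yes (u , u∈W) =
        0 , inj₂ (subst (λ V → Elimination G V W 0) (branching⇒≡ {C = C} uniq branching u∈W) stop)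
      ...   | no empty = 0 , inj₁ (subst (λ V → Elimination G V W 0) (Subset.Empty-unique empty) stop)

-- Signs, 2-periodic sequences, and residues

skew-±1 : ∀ {n} (G : OrientedGraph n) {x y} → Adjacent G x y →
  skewAdjacency G x y ≡ 1ℚ ⊎ skewAdjacency G x y ≡ ℚ.- 1ℚ
skew-±1 G (fwd xy) = inj₁ (skew-arc G xy)
skew-±1 G (bwd yx) = inj₂ (skew-arc⁻ G yx)

∏-snoc : ∀ (f : ℕ → ℚ) i → ∏ {suc i} (f ∘ toℕ) ≡ ∏ {i} (f ∘ toℕ) ℚ.* f i
∏-snoc f zero    = ℚₚ.*-comm (f 0) 1ℚ
∏-snoc f (suc i) = trans (cong (f 0 ℚ.*_) (∏-snoc (f ∘ suc) i)) (sym (ℚₚ.*-assoc (f 0) _ (f (suc i))))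

neg-fixed⇒0 : ∀ z → z ≡ ℚ.- z → z ≡ 0ℚ
neg-fixed⇒0 (ℚ.mkℚ (ℤ.+ zero) d c) eq = ℚₚ.↥p≡0⇒p≡0 _ refl
neg-fixed⇒0 (ℚ.mkℚ ℤ.+[1+ _ ] d c) ()
neg-fixed⇒0 (ℚ.mkℚ ℤ.-[1+ _ ] d c) ()

-- The general 2-periodic sequence, parametrised by its two initial values; on the cycle it
-- describes the candidates for twisted kernel vectors.
alternate : {A : Set} → A → A → ℕ → A
alternate α β 0             = α
alternate α β 1             = β
alternate α β (suc (suc i)) = alternate α β i

module _ {A : Set} (f : ℕ → A) (2-periodic : ∀ i → f (2 + i) ≡ f i) where

  2-periodic-even : ∀ h → f (h * 2) ≡ f 0
  2-periodic-even zero    = refl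
  2-periodic-even (suc h) = trans (2-periodic (h * 2)) (2-periodic-even h)

  2-periodic-odd : ∀ h → f (suc (h * 2)) ≡ f 1
  2-periodic-odd zero    = refl
  2-periodic-odd (suc h) = trans (2-periodic (suc (h * 2))) (2-periodic-odd h)

  2-periodic-const : ∀ {c} → f 0 ≡ c → f 1 ≡ c → ∀ i → f i ≡ c
  2-periodic-const f0 f1 0             = f0
  2-periodic-const f0 f1 1             = f1
  2-periodic-const f0 f1 (suc (suc i)) = trans (2-periodic i) (2-periodic-const f0 f1 i)

periodic-% : ∀ {A : Set} (f : ℕ → A) k .{{_ : NonZero k}} → (∀ i → f (i + k) ≡ f i) → ∀ i → f (i % k) ≡ f i
periodic-% f k per i = sym (trans (cong f (m≡m%n+[m/n]*n i k)) (drop (i / k)))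
  where
  drop : ∀ q → f (i % k + q * k) ≡ f (i % k)
  drop zero    = cong f (ℕₚ.+-identityʳ (i % k))
  drop (suc q) = trans
    (cong f (trans (cong (i % k +_) (ℕₚ.+-comm k (q * k))) (sym (ℕₚ.+-assoc (i % k) (q * k) k))))
    (trans (per (i % k + q * k)) (drop q))

-- The residue of `i` plus `d` is below 2k, so reducing it subtracts 0 or `k`. Equality with the
-- residue of `i` would thus make `d` equal to 0 or `k`.
shift-%-≢ : ∀ i {d} k .{{_ : NonZero k}} → 0 < d → d < k → (i + d) % k ≢ i % k
shift-%-≢ i {d} k 0<d d<k eq = [ no-wrap , wrap ]′ (ℕₚ.<-≤-connex (i % k + d) k)
  where
  reduced : (i % k + d) % k ≡ i % k
  reduced = trans (cong (λ t → (i % k + t) % k) (sym (m<n⇒m%n≡m d<k)))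
    (trans (sym (%-distribˡ-+ i d k)) eq)

  no-wrap : ¬ (i % k + d < k)
  no-wrap r+d<k = ℕₚ.<⇒≢ 0<d (sym (ℕₚ.+-cancelˡ-≡ (i % k) d 0
    (trans (sym (m<n⇒m%n≡m r+d<k)) (trans reduced (sym (ℕₚ.+-identityʳ (i % k)))))))

  wrap : ¬ (k ≤ i % k + d)
  wrap k≤r+d = ℕₚ.<⇒≢ d<k (ℕₚ.+-cancelˡ-≡ (i % k) d k (trans (sym s+k≡r+d) (cong (_+ k) s≡r)))
    where
    s = i % k + d ∸ k
    s+k≡r+d : s + k ≡ i % k + d
    s+k≡r+d = ℕₚ.m∸n+n≡m k≤r+d
    s<k : s < k
    s<k = ℕₚ.<-trans (ℕₚ.+-cancelʳ-< k s d (subst₂ _<_ (sym s+k≡r+d) (ℕₚ.+-comm k d)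
      (ℕₚ.+-monoˡ-< d (m%n<n i k)))) d<k
    s≡r : s ≡ i % k
    s≡r = trans (sym (m<n⇒m%n≡m s<k))
      (trans (sym ([m+n]%n≡m%n s k)) (trans (cong (_% k) s+k≡r+d) reduced))

even≢odd : ∀ i j → i * 2 ≢ suc (j * 2)
even≢odd (suc i) (suc j) eq = even≢odd i j (ℕₚ.suc-injective (ℕₚ.suc-injective eq))

ends : ∀ {n} → List (Edge n) → List (Fin n)
ends []            = []
ends ((a , b) ∷ M) = a ∷ b ∷ ends M

length-ends : ∀ {n} (M : List (Edge n)) → length (ends M) ≡ length M * 2
length-ends []      = refl
length-ends (_ ∷ M) = cong (2 +_) (length-ends M)

∈ends⁻ : ∀ {n} {M : List (Edge n)} {x} → x ∈ ends M → ∃[ e ] e ∈ M × Incident x e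
∈ends⁻ {M = _ ∷ _} (here x≡a)         = _ , here refl , inj₁ x≡a
∈ends⁻ {M = _ ∷ _} (there (here x≡b)) = _ , here refl , inj₂ x≡b
∈ends⁻ {M = _ ∷ _} (there (there x∈)) with ∈ends⁻ x∈
... | e , e∈ , xe = e , there e∈ , xe

ends-unique : ∀ {n} {G : OrientedGraph n} {W M} → Matching G W M → Unique (ends M)
ends-unique {M = []} _ = []
ends-unique {G = G} {W} {(a , b) ∷ M} isM with unique isM
... | e≢ ∷ u = ∉∷-unique
    (λ { (here a≡b) → adjacent-irrefl G (fwd (arc isM (here refl))) a≡b ; (there a∈) → fresh (inj₁ refl) a∈ })
    (∉∷-unique (fresh (inj₂ refl)) (ends-unique rest))
  where
  fresh : ∀ {x} → Incident x (a , b) → x ∉ ends M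
  fresh xe x∈ with ∈ends⁻ x∈
  ... | f , f∈ , xf = All.lookup e≢ f∈ (meet isM (here refl) (there f∈) xe xf)
  rest : Matching G W M
  rest = record
    { arc = arc isM ∘ there ; within = within isM ∘ there
    ; meet = λ e∈ f∈ → meet isM (there e∈) (there f∈) ; unique = u }

-- The kernel of the skew-adjacency matrix on the cycle

module OnCycle {n k-1} {G : OrientedGraph n} (C : Cycle G (suc k-1)) (uniq : IsUniqueCycle C) where

  k : ℕ
  k = suc k-1

  S : Subset n
  S = vertexSet C

  -- The vertices of the cycle, indexed modulo k.
  u : ℕ → Fin n
  u i = vertex C (i mod k)

  mod-cong : ∀ i j → i % k ≡ j % k → i mod k ≡ j mod k
  mod-cong i j eq = toℕ-injective (trans (toℕ-fromℕ< _) (trans eq (sym (toℕ-fromℕ< _))))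

  u-toℕ : ∀ i → u (toℕ i) ≡ vertex C i
  u-toℕ i = cong (vertex C) (toℕ-injective (trans (toℕ-fromℕ< _) (m<n⇒m%n≡m (toℕ<n i))))

  suc-mod : ∀ i → next (i mod k) ≡ suc i mod k
  suc-mod i = mod-cong (suc (toℕ (i mod k))) (suc i) (trans (cong (λ t → suc t % k) (toℕ-fromℕ< (m%n<n i k)))
    (trans (%-distribˡ-+ 1 (i % k) k)
      (trans (cong (λ t → (1 % k + t) % k) (m%n%n≡m%n i k)) (sym (%-distribˡ-+ 1 i k)))))

  u-suc : ∀ i → vertex C (next (i mod k)) ≡ u (suc i)
  u-suc i = cong (vertex C) (suc-mod i)

  u-adjacent : ∀ i → Adjacent G (u i) (u (suc i))
  u-adjacent i = subst (Adjacent G (u i)) (u-suc i) (adjacent C (i mod k))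

  u-periodic : ∀ i → u (i + k) ≡ u i
  u-periodic i = cong (vertex C) (mod-cong (i + k) i ([m+n]%n≡m%n i k))

  u-distinct : ∀ {i j} → i < j → j < i + k → u i ≢ u j
  u-distinct {i} {j} i<j j<i+k eq = shift-%-≢ i k (ℕₚ.m<n⇒0<n∸m i<j)
    (subst (j ∸ i <_) (ℕₚ.m+n∸m≡n i k) (ℕₚ.∸-monoˡ-< j<i+k (ℕₚ.<⇒≤ i<j)))
    (trans (cong (_% k) (ℕₚ.m+[n∸m]≡n (ℕₚ.<⇒≤ i<j)))
      (trans (sym (toℕ-fromℕ< (m%n<n j k)))
        (trans (cong toℕ (sym (injective C eq))) (toℕ-fromℕ< (m%n<n i k)))))

  -- The window may start anywhere: a chord cuts off a path that starts at its own end, and one of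
  -- the perfect matchings starts at `u 1`.
  u-injective : ∀ b {i j} → i < k → j < k → u (b + i) ≡ u (b + j) → i ≡ j
  u-injective b {i} {j} i<k j<k eq with ℕₚ.<-cmp i j
  ... | tri≈ _ i≡j _ = i≡j
  ... | tri< i<j _ _ = contradiction eq (u-distinct (ℕₚ.+-monoʳ-< b i<j)
    (ℕₚ.<-≤-trans (ℕₚ.+-monoʳ-< b j<k) (ℕₚ.+-monoˡ-≤ k (ℕₚ.m≤m+n b i))))
  ... | tri> _ _ j<i = contradiction (sym eq) (u-distinct (ℕₚ.+-monoʳ-< b j<i)
    (ℕₚ.<-≤-trans (ℕₚ.+-monoʳ-< b i<k) (ℕₚ.+-monoˡ-≤ k (ℕₚ.m≤m+n b j))))

  u-≢-2 : ∀ i → u i ≢ u (2 + i)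
  u-≢-2 i = u-distinct (ℕₚ.m≤n⇒m≤1+n (ℕₚ.n<1+n i))
    (subst (_< i + k) (ℕₚ.+-comm i 2) (ℕₚ.+-monoʳ-< i (3≤k C)))

  u-suc-cong : ∀ {i j} → u i ≡ u j → u (suc i) ≡ u (suc j)
  u-suc-cong {i} {j} eq = trans (sym (u-suc i))
    (trans (cong (vertex C ∘ next) (injective C eq)) (u-suc j))

  u-+-cong : ∀ d {i j} → u i ≡ u j → u (d + i) ≡ u (d + j)
  u-+-cong zero    eq = eq
  u-+-cong (suc d) eq = u-suc-cong (u-+-cong d eq)

  -- Indices are natural numbers, so a step back is taken as `k-1` steps forward.
  u-pred : ∀ i → u (k-1 + suc i) ≡ u i
  u-pred i = trans (cong u (trans (ℕₚ.+-suc k-1 i) (ℕₚ.+-comm k i))) (u-periodic i)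

  u-suc-injective : ∀ {i j} → u (suc i) ≡ u (suc j) → u i ≡ u j
  u-suc-injective {i} {j} eq = trans (sym (u-pred i)) (trans (u-+-cong k-1 eq) (u-pred j))

  u∈S : ∀ i → u i ∈ˢ S
  u∈S i = ∈vertexSet⁺ {C = C} (i mod k)

  ∈S⁻ : ∀ {x} → x ∈ˢ S → ∃[ i ] i < k × x ≡ u i
  ∈S⁻ x∈S with ∈vertexSet⁻ {C = C} x∈S
  ... | i , refl = toℕ i , toℕ<n i , sym (u-toℕ i)

  -- With a successor as index, both neighbours on the cycle, `u i` and `u (2 + i)`, are named
  -- without subtraction.
  ∈S⁻-suc : ∀ {x} → x ∈ˢ S → ∃[ i ] x ≡ u (suc i)
  ∈S⁻-suc x∈S with ∈S⁻ x∈S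
  ... | i , _ , refl = k-1 + i , sym (trans (cong u (sym (ℕₚ.+-suc k-1 i))) (u-pred i))

  vertex-next : ∀ i → vertex C (next i) ≡ u (suc (toℕ i))
  vertex-next i = trans (cong (vertex C ∘ next) (injective C (sym (u-toℕ i)))) (u-suc (toℕ i))

  EdgeOf⁻ : ∀ {x y} → EdgeOf C x y → ∃[ i ] ((x ≡ u i × y ≡ u (suc i)) ⊎ (y ≡ u i × x ≡ u (suc i)))
  EdgeOf⁻ (i , inj₁ (refl , refl)) = toℕ i , inj₁ (sym (u-toℕ i) , vertex-next i)
  EdgeOf⁻ (i , inj₂ (refl , refl)) = toℕ i , inj₂ (sym (u-toℕ i) , vertex-next i)

  -- A chord together with an arc of C between its ends would form a second cycle.
  chord : ∀ {i j} → i < j → j < k → Adjacent G (u i) (u j) → EdgeOf C (u j) (u i)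
  chord {i} {j} i<j j<k ij with ℕₚ.m≤n⇒m<n∨m≡n i<j
  ... | inj₂ refl = i mod k , inj₂ (refl , sym (u-suc i))
  -- The chord is the closing edge of `D`, from its last vertex `u j` back to `u i`, and uniqueness
  -- puts it on `C`.
  ... | inj₁ i+1<j = Equivalence.to (uniq D (u j) (u i))
      (last , inj₁ (sym (trans (cong w (toℕ-fromℕ< d<l)) w-last) ,
                    sym (trans (cong w (next-last {G = G} last (cong suc (toℕ-fromℕ< d<l)))) w-first)))
    where
    d = j ∸ i
    w : ℕ → Fin n
    w t = u (i + t)
    i+d≡j : i + d ≡ j
    i+d≡j = ℕₚ.m+[n∸m]≡n (ℕₚ.<⇒≤ i<j)
    w-first : w 0 ≡ u i
    w-first = cong u (ℕₚ.+-identityʳ i)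
    w-last : w d ≡ u j
    w-last = cong u i+d≡j
    d<k : d < k
    d<k = ℕₚ.≤-<-trans (ℕₚ.m∸n≤m j i) j<k
    2≤d : 2 ≤ d
    2≤d = ℕₚ.+-cancelˡ-≤ i 2 d (subst₂ _≤_ (ℕₚ.+-comm 2 i) (sym i+d≡j) i+1<j)
    D : Cycle G (suc d)
    D = sequence⇒cycle (s≤s 2≤d) w
      (λ { {a} {b} a<b (s≤s b≤d) eq → ℕₚ.<⇒≢ a<b
        (u-injective i (ℕₚ.<-trans a<b (ℕₚ.≤-<-trans b≤d d<k)) (ℕₚ.≤-<-trans b≤d d<k) eq) })
      (λ t _ → subst (Adjacent G (w t)) (cong u (sym (ℕₚ.+-suc i t))) (u-adjacent (i + t)))
      (λ { t refl → subst₂ (Adjacent G) (sym w-last) (sym w-first) (adjacent-sym G ij) })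
    d<l = ℕₚ.n<1+n d
    last = fromℕ< d<l

  -- The cycle is an induced subgraph: by `chord`, an edge between two of its vertices is an edge of
  -- the cycle.
  u-neighbours : ∀ i {y} → y ∈ˢ S → Adjacent G (u (suc i)) y → y ≡ u i ⊎ y ≡ u (2 + i)
  u-neighbours i {y} y∈S adj with EdgeOf⁻ edge-of-C
    where
    edge-of-C : EdgeOf C (u (suc i)) y
    edge-of-C with ∈S⁻ (u∈S (suc i)) | ∈S⁻ y∈S
    ... | a , a<k , eq | b , b<k , refl with ℕₚ.<-cmp a b
    ...   | tri≈ _ refl _ = contradiction eq (adjacent-irrefl G adj)
    ...   | tri> _ _ b<a = subst (λ x → EdgeOf C x (u b)) (sym eq)
      (chord b<a a<k (adjacent-sym G (subst (λ x → Adjacent G x (u b)) eq adj)))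
    ...   | tri< a<b _ _ with chord a<b b<k (subst (λ x → Adjacent G x (u b)) eq adj)
    ...     | l , inj₁ (p , q) = l , inj₂ (p , trans eq q)
    ...     | l , inj₂ (p , q) = l , inj₁ (trans eq p , q)
  ... | a , inj₁ (p , q) = inj₂ (trans q (u-suc-cong {a} {suc i} (sym p)))
  ... | a , inj₂ (p , q) = inj₁ (trans p (u-suc-injective {a} {i} (sym q)))

  A : Matrix n n
  A = skewAdjacency G

  a : ℕ → ℚ
  a i = A (u i) (u (suc i))

  a² : ∀ i → a i ℚ.* a i ≡ 1ℚ
  a² i = skew-square G (u-adjacent i)

  a-periodic : ∀ i → a (i + k) ≡ a i
  a-periodic i = cong₂ A (u-periodic i) (u-periodic (suc i))

  abstract

    -- A change of gauge: scaling coordinate `i` by `sign i` turns every entry along the path into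
    -- 1. What is left after one round is `sign k`, the sign of `C`.
    sign : ℕ → ℚ
    sign i = ∏ {i} (a ∘ toℕ)

    sign-zero : sign 0 ≡ 1ℚ
    sign-zero = refl

    sign-suc : ∀ i → sign (suc i) ≡ sign i ℚ.* a i
    sign-suc = ∏-snoc a

    sign-cycle : (∏ λ i → A (vertex C i) (vertex C (next i))) ≡ sign k
    sign-cycle = ∏-cong λ i → cong₂ A (sym (u-toℕ i)) (vertex-next i)

  sign-±1 : ∀ i → sign i ≡ 1ℚ ⊎ sign i ≡ ℚ.- 1ℚ
  sign-±1 zero = inj₁ sign-zero
  sign-±1 (suc i) with sign-±1 i | skew-±1 G (u-adjacent i)
  ... | inj₁ s | inj₁ t = inj₁ (trans (sign-suc i) (cong₂ ℚ._*_ s t))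
  ... | inj₁ s | inj₂ t = inj₂ (trans (sign-suc i) (cong₂ ℚ._*_ s t))
  ... | inj₂ s | inj₁ t = inj₂ (trans (sign-suc i) (cong₂ ℚ._*_ s t))
  ... | inj₂ s | inj₂ t = inj₁ (trans (sign-suc i) (cong₂ ℚ._*_ s t))

  sign² : ∀ i → sign i ℚ.* sign i ≡ 1ℚ
  sign² i with sign-±1 i
  ... | inj₁ s = cong₂ ℚ._*_ s s
  ... | inj₂ s = cong₂ ℚ._*_ s s

  sign-shift : ∀ i → sign (i + k) ≡ sign k ℚ.* sign i
  sign-shift zero    = sym (trans (cong (sign k ℚ.*_) sign-zero) (ℚₚ.*-identityʳ (sign k)))
  sign-shift (suc i) = begin
    sign (suc (i + k))               ≡⟨ sign-suc (i + k) ⟩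
    sign (i + k) ℚ.* a (i + k)       ≡⟨ cong₂ ℚ._*_ (sign-shift i) (a-periodic i) ⟩
    sign k ℚ.* sign i ℚ.* a i        ≡⟨ ℚₚ.*-assoc (sign k) (sign i) (a i) ⟩
    sign k ℚ.* (sign i ℚ.* a i)      ≡⟨ cong (sign k ℚ.*_) (sign-suc i) ⟨
    sign k ℚ.* sign (suc i)          ∎
    where open ≡-Reasoning

  evenly⇒sign : EvenlyOriented C → sign k ≡ 1ℚ
  evenly⇒sign 0<∏ with sign-±1 k
  ... | inj₁ s = s
  ... | inj₂ s = contradiction (subst (0ℚ ℚ.<_) (trans sign-cycle s) 0<∏) (from-no (0ℚ ℚₚ.<? ℚ.- 1ℚ))

  ¬evenly⇒sign : ¬ EvenlyOriented C → sign k ≡ ℚ.- 1ℚ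
  ¬evenly⇒sign ¬0<∏ with sign-±1 k
  ... | inj₁ s = contradiction (subst (0ℚ ℚ.<_) (sym (trans sign-cycle s)) (from-yes (0ℚ ℚₚ.<? 1ℚ))) ¬0<∏
  ... | inj₂ s = s

  module _ {x : Vector ℚ n} (supported : ∀ {i} → i ∉ˢ S → x i ≡ 0ℚ) where

    row : ∀ i → (A *ᵥ x) (u (suc i)) ≡ a (suc i) ℚ.* x (u (2 + i)) ℚ.- a i ℚ.* x (u i)
    row i = trans
      (supported-pair {A = A} supported {u (suc i)} {u (2 + i)} {u i} (u-≢-2 i ∘ sym)
        λ j j∈S j≢ j≢′ → skew-¬adjacent G λ adj → [ j≢′ , j≢ ]′ (u-neighbours i j∈S adj))
      (cong (a (suc i) ℚ.* x (u (2 + i)) ℚ.+_)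
        (trans (cong (ℚ._* x (u i)) (skew-antisym G (u i) (u (suc i))))
          (sym (ℚₚ.neg-distribˡ-* (a i) (x (u i))))))

  module _ {x} (ker : Kernel A S x) where

    -- The twist by the partial sign products turns the kernel equations into
    -- y (2 + i) ≡ y i.
    y : ℕ → ℚ
    y i = sign i ℚ.* x (u i)

    kernel-relation : ∀ i → a (suc i) ℚ.* x (u (2 + i)) ≡ a i ℚ.* x (u i)
    kernel-relation i = p-q≡0⇒p≡q (trans (sym (row (support ker) i)) (vanish ker (u∈S (suc i))))
      where
      p-q≡0⇒p≡q : ∀ {p q} → p ℚ.- q ≡ 0ℚ → p ≡ q
      p-q≡0⇒p≡q {p} {q} eq = begin
        p                        ≡⟨ ℚₚ.+-identityʳ p ⟨
        p ℚ.+ 0ℚ                 ≡⟨ cong (p ℚ.+_) (ℚₚ.+-inverseˡ q) ⟨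
        p ℚ.+ (ℚ.- q ℚ.+ q)      ≡⟨ ℚₚ.+-assoc p (ℚ.- q) q ⟨
        p ℚ.- q ℚ.+ q            ≡⟨ cong (ℚ._+ q) eq ⟩
        0ℚ ℚ.+ q                 ≡⟨ ℚₚ.+-identityˡ q ⟩
        q                        ∎
        where open ≡-Reasoning

    y-2-periodic : ∀ i → y (2 + i) ≡ y i
    y-2-periodic i = begin
      sign (2 + i) ℚ.* x (u (2 + i))                       ≡⟨ cong (ℚ._* x (u (2 + i))) (sign-suc (suc i)) ⟩
      sign (suc i) ℚ.* a (suc i) ℚ.* x (u (2 + i))         ≡⟨ ℚₚ.*-assoc (sign (suc i)) (a (suc i)) _ ⟩
      sign (suc i) ℚ.* (a (suc i) ℚ.* x (u (2 + i)))       ≡⟨ cong₂ ℚ._*_ (sign-suc i) (kernel-relation i) ⟩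
      sign i ℚ.* a i ℚ.* (a i ℚ.* x (u i))                 ≡⟨ ℚₚ.*-assoc (sign i) (a i) _ ⟩
      sign i ℚ.* (a i ℚ.* (a i ℚ.* x (u i)))               ≡⟨ cong (sign i ℚ.*_) (involution-cancelˡ (a i) _ (a² i)) ⟩
      sign i ℚ.* x (u i)                                   ∎
      where open ≡-Reasoning

    y-shift : ∀ i → y (i + k) ≡ sign k ℚ.* y i
    y-shift i = trans (cong₂ ℚ._*_ (sign-shift i) (cong x (u-periodic i)))
      (ℚₚ.*-assoc (sign k) (sign i) (x (u i)))

    y-zero : ∀ {i} → x (u i) ≡ 0ℚ → y i ≡ 0ℚ
    y-zero {i} = x*0≡0 (sign i)

    kernel-trivial : y 0 ≡ 0ℚ → y 1 ≡ 0ℚ → ∀ i → x i ≡ 0ℚ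
    kernel-trivial y0 y1 v with v Subset.∈? S
    ... | no v∉S = support ker v∉S
    ... | yes v∈S with ∈S⁻ v∈S
    ...   | i , _ , refl =
      involution-zero (sign i) (x (u i)) (sign² i) (2-periodic-const y y-2-periodic y0 y1 i)

  module _ (α β : ℚ) (wrap₀ : sign k ℚ.* alternate α β k ≡ α)
           (wrap₁ : sign k ℚ.* alternate α β (suc k) ≡ β) where

    z : ℕ → ℚ
    z i = sign i ℚ.* alternate α β i

    -- The hypotheses `wrap₀` and `wrap₁` are the closing conditions at the indices 0 and 1; as the
    -- alternating sequence is 2-periodic, they imply the conditions at all indices.
    z-periodic : ∀ i → z (i + k) ≡ z i
    z-periodic i = begin
      sign (i + k) ℚ.* alternate α β (i + k)           ≡⟨ cong (ℚ._* alternate α β (i + k)) (sign-shift i) ⟩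
      sign k ℚ.* sign i ℚ.* alternate α β (i + k)      ≡⟨ cong (ℚ._* alternate α β (i + k)) (ℚₚ.*-comm (sign k) (sign i)) ⟩
      sign i ℚ.* sign k ℚ.* alternate α β (i + k)      ≡⟨ ℚₚ.*-assoc (sign i) (sign k) _ ⟩
      sign i ℚ.* (sign k ℚ.* alternate α β (i + k))    ≡⟨ cong (sign i ℚ.*_) (wrap i) ⟩
      z i                                              ∎
      where
      open ≡-Reasoning
      wrap : ∀ i → sign k ℚ.* alternate α β (i + k) ≡ alternate α β i
      wrap 0             = wrap₀
      wrap 1             = wrap₁
      wrap (suc (suc i)) = wrap i

    z-relation : ∀ i → a (suc i) ℚ.* z (2 + i) ≡ a i ℚ.* z i
    z-relation i = begin
      a (suc i) ℚ.* (sign (2 + i) ℚ.* α′)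
        ≡⟨ cong (λ s → a (suc i) ℚ.* (s ℚ.* α′)) (trans (sign-suc (suc i)) (ℚₚ.*-comm (sign (suc i)) (a (suc i)))) ⟩
      a (suc i) ℚ.* (a (suc i) ℚ.* sign (suc i) ℚ.* α′)
        ≡⟨ cong (a (suc i) ℚ.*_) (ℚₚ.*-assoc (a (suc i)) (sign (suc i)) α′) ⟩
      a (suc i) ℚ.* (a (suc i) ℚ.* (sign (suc i) ℚ.* α′))
        ≡⟨ involution-cancelˡ (a (suc i)) _ (a² (suc i)) ⟩
      sign (suc i) ℚ.* α′
        ≡⟨ cong (ℚ._* α′) (trans (sign-suc i) (ℚₚ.*-comm (sign i) (a i))) ⟩
      a i ℚ.* sign i ℚ.* α′
        ≡⟨ ℚₚ.*-assoc (a i) (sign i) α′ ⟩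
      a i ℚ.* z i ∎
      where
      open ≡-Reasoning
      α′ = alternate α β i

    cycleVector : Vector ℚ n
    cycleVector v with any? (λ i → vertex C i ≟ᶠ v)
    ... | yes (i , _) = z (toℕ i)
    ... | no _        = 0ℚ

    cycleVector-u : ∀ i → cycleVector (u i) ≡ z i
    cycleVector-u i with any? (λ j → vertex C j ≟ᶠ u i)
    ... | yes (j , eq) = trans (cong z (trans (cong toℕ (injective C eq)) (toℕ-fromℕ< (m%n<n i k))))
      (periodic-% z k z-periodic i)
    ... | no none = contradiction (i mod k , refl) none

    cycleVector-kernel : Kernel A S cycleVector
    cycleVector-kernel = record { support = supp ; vanish = van }
      where
      supp : ∀ {i} → i ∉ˢ S → cycleVector i ≡ 0ℚ
      supp {i} i∉S with any? (λ j → vertex C j ≟ᶠ i)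
      ... | yes (j , refl) = contradiction (∈vertexSet⁺ {C = C} j) i∉S
      ... | no _           = refl

      van : ∀ {i} → i ∈ˢ S → (A *ᵥ cycleVector) i ≡ 0ℚ
      van i∈S with ∈S⁻-suc i∈S
      ... | i , refl = begin
        (A *ᵥ cycleVector) (u (suc i))                                   ≡⟨ row supp i ⟩
        a (suc i) ℚ.* cycleVector (u (2 + i)) ℚ.- a i ℚ.* cycleVector (u i)
          ≡⟨ cong₂ (λ s t → a (suc i) ℚ.* s ℚ.- a i ℚ.* t) (cycleVector-u (2 + i)) (cycleVector-u i) ⟩
        a (suc i) ℚ.* z (2 + i) ℚ.- a i ℚ.* z i                          ≡⟨ cong (ℚ._- (a i ℚ.* z i)) (z-relation i) ⟩
        a i ℚ.* z i ℚ.- a i ℚ.* z i                                      ≡⟨ ℚₚ.+-inverseʳ (a i ℚ.* z i) ⟩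
        0ℚ                                                               ∎
        where open ≡-Reasoning

  module _ (d : ℕ) (d≤k : d ≤ k) where

    verticesFrom : List (Fin n)
    verticesFrom = applyUpTo (λ i → u (d + i)) (k ∸ d)

    verticesFrom-complete : ∀ {v} → v ∈ˢ S → v ∉ verticesFrom → ∃[ i ] i < d × v ≡ u i
    verticesFrom-complete v∈S v∉ with ∈S⁻ v∈S
    ... | i , i<k , refl with ℕₚ.<-≤-connex i d
    ...   | inj₁ i<d = i , i<d , refl
    ...   | inj₂ d≤i = contradiction
      (subst (_∈ verticesFrom) (cong u (ℕₚ.m+[n∸m]≡n d≤i))
        (∈-applyUpTo⁺ (λ i → u (d + i)) (ℕₚ.∸-monoˡ-< i<k d≤i)))
      v∉

    ∉verticesFrom : ∀ {i} → i < d → u i ∉ verticesFrom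
    ∉verticesFrom {i} i<d u∈ with ∈-applyUpTo⁻ (λ i → u (d + i)) u∈
    ... | j , j<k∸d , eq = contradiction (u-injective 0 (ℕₚ.<-≤-trans i<d d≤k) d+j<k eq)
      (ℕₚ.<⇒≢ (ℕₚ.<-≤-trans i<d (ℕₚ.m≤m+n d j)))
      where
      d+j<k : d + j < k
      d+j<k = subst (d + j <_) (ℕₚ.m+[n∸m]≡n d≤k) (ℕₚ.+-monoʳ-< d j<k∸d)

    -- Here `d` is the dimension of the kernel: the coordinates at the `d` vertices from `u 0` on
    -- are free, and the other vertices index the basis columns.
    cycle-columnBasis :
      (∀ (f : Vector ℚ n) → ∃[ x ] Kernel A S x × (∀ {i} → i < d → x (u i) ≡ f (u i))) →
      (∀ {x} → Kernel A S x → (∀ {i} → i < d → x (u i) ≡ 0ℚ) → ∀ i → x i ≡ 0ℚ) →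
      ∃[ us ] length us ≡ k ∸ d × ColumnBasis A S us
    cycle-columnBasis ext triv = verticesFrom , length-applyUpTo _ (k ∸ d) , record
      { unique  = Unique.applyUpTo⁺₁ (λ i → u (d + i)) (k ∸ d) λ i<j j< →
          u-distinct (ℕₚ.+-monoʳ-< d i<j) (ℕₚ.<-≤-trans (ℕₚ.+-monoʳ-< d (ℕₚ.<-≤-trans j< (ℕₚ.m∸n≤m k d)))
            (ℕₚ.+-monoˡ-≤ k (ℕₚ.m≤m+n d _)))
      ; members = λ v∈ → case ∈-applyUpTo⁻ (λ i → u (d + i)) v∈ of λ { (j , _ , refl) → u∈S (d + j) }
      ; extend  = extend′
      ; trivial = λ ker zeros → triv ker (λ i<d → zeros (∉verticesFrom i<d))
      }
      where
      extend′ : ∀ f → ∃[ x ] Kernel A S x × (∀ {i} → i ∈ˢ S → i ∉ verticesFrom → x i ≡ f i)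
      extend′ f with ext f
      ... | x , ker , agree = x , ker , agree′
        where
        agree′ : ∀ {i} → i ∈ˢ S → i ∉ verticesFrom → x i ≡ f i
        agree′ i∈S i∉ with verticesFrom-complete i∈S i∉
        ... | j , j<d , refl = agree j<d

  cycleVector-0 : ∀ α β w₀ w₁ → cycleVector α β w₀ w₁ (u 0) ≡ α
  cycleVector-0 α β w₀ w₁ = trans (cycleVector-u α β w₀ w₁ 0)
    (trans (cong (ℚ._* α) sign-zero) (ℚₚ.*-identityˡ α))

  module _ (h : ℕ) where

    -- A shift by an odd `k` exchanges the two parity classes of the alternating sequence, so one
    -- value is `sign k` times the other and a single free coordinate remains, whatever the sign.
    odd-columnBasis : k ≡ suc (h * 2) → ∃[ us ] length us ≡ k ∸ 1 × ColumnBasis A S us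
    odd-columnBasis k≡ = cycle-columnBasis 1 (s≤s z≤n) ext triv
      where
      triv : ∀ {x} → Kernel A S x → (∀ {i} → i < 1 → x (u i) ≡ 0ℚ) → ∀ i → x i ≡ 0ℚ
      triv {x} ker zeros = kernel-trivial ker y0≡0 (begin
        y ker 1              ≡⟨ 2-periodic-odd (y ker) (y-2-periodic ker) h ⟨
        y ker (suc (h * 2))  ≡⟨ cong (y ker) k≡ ⟨
        y ker k              ≡⟨ y-shift ker 0 ⟩
        sign k ℚ.* y ker 0   ≡⟨ x*0≡0 (sign k) y0≡0 ⟩
        0ℚ                   ∎)
        where
        open ≡-Reasoning
        y0≡0 : y ker 0 ≡ 0ℚ
        y0≡0 = y-zero ker {0} (zeros z<s)

      ext : ∀ f → ∃[ x ] Kernel A S x × (∀ {i} → i < 1 → x (u i) ≡ f (u i))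
      ext f = cycleVector α β w₀ w₁ , cycleVector-kernel α β w₀ w₁ ,
        λ { z<s → cycleVector-0 α β w₀ w₁ }
        where
        α = f (u 0)
        β = sign k ℚ.* α
        w₀ : sign k ℚ.* alternate α β k ≡ α
        w₀ = trans (cong (sign k ℚ.*_)
            (trans (cong (alternate α β) k≡) (2-periodic-odd (alternate α β) (λ _ → refl) h)))
          (involution-cancelˡ (sign k) α (sign² k))
        w₁ : sign k ℚ.* alternate α β (suc k) ≡ β
        w₁ = cong (sign k ℚ.*_)
          (trans (cong (alternate α β ∘ suc) k≡) (2-periodic-even (alternate α β) (λ _ → refl) h))

    module _ (k≡ : k ≡ h * 2) where

      alternate-k : ∀ (α β : ℚ) → alternate α β k ≡ α
      alternate-k α β = trans (cong (alternate α β) k≡) (2-periodic-even (alternate α β) (λ _ → refl) h)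

      alternate-suc-k : ∀ (α β : ℚ) → alternate α β (suc k) ≡ β
      alternate-suc-k α β =
        trans (cong (alternate α β ∘ suc) k≡) (2-periodic-odd (alternate α β) (λ _ → refl) h)

      -- A shift by an even `k` preserves both parity classes, so with sign 1 closing up imposes no
      -- condition and both values are free.
      even-columnBasis : sign k ≡ 1ℚ → ∃[ us ] length us ≡ k ∸ 2 × ColumnBasis A S us
      even-columnBasis s≡1 = cycle-columnBasis 2 (ℕₚ.<⇒≤ (3≤k C)) ext
        λ ker zeros → kernel-trivial ker (y-zero ker {0} (zeros z<s)) (y-zero ker {1} (zeros (s<s z<s)))
        where
        ext : ∀ f → ∃[ x ] Kernel A S x × (∀ {i} → i < 2 → x (u i) ≡ f (u i))
        ext f = cycleVector α β w₀ w₁ , cycleVector-kernel α β w₀ w₁ , λ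
          { z<s → cycleVector-0 α β w₀ w₁
          ; (s<s z<s) → trans (cycleVector-u α β w₀ w₁ 1) (involution-cancelˡ (sign 1) _ (sign² 1)) }
          where
          α = f (u 0)
          -- The factor `sign 1` cancels the twist at index 1, so that the prescribed value appears
          -- at `u 1`; at index 0 the twist is 1.
          β = sign 1 ℚ.* f (u 1)
          w₀ : sign k ℚ.* alternate α β k ≡ α
          w₀ = trans (cong₂ ℚ._*_ s≡1 (alternate-k α β)) (ℚₚ.*-identityˡ α)
          w₁ : sign k ℚ.* alternate α β (suc k) ≡ β
          w₁ = trans (cong₂ ℚ._*_ s≡1 (alternate-suc-k α β)) (ℚₚ.*-identityˡ β)

      -- With sign -1 each of the two values has to equal its own negative, so the kernel is zero.
      even-columnBasis⁻ : sign k ≡ ℚ.- 1ℚ → ∃[ us ] length us ≡ k ∸ 0 × ColumnBasis A S us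
      even-columnBasis⁻ s≡-1 = cycle-columnBasis 0 z≤n ext triv
        where
        ext : ∀ f → ∃[ x ] Kernel A S x × (∀ {i} → i < 0 → x (u i) ≡ f (u i))
        ext f = cycleVector 0ℚ 0ℚ w₀ w₁ , cycleVector-kernel 0ℚ 0ℚ w₀ w₁ , λ ()
          where
          w₀ : sign k ℚ.* alternate 0ℚ 0ℚ k ≡ 0ℚ
          w₀ = x*0≡0 (sign k) (alternate-k 0ℚ 0ℚ)
          w₁ : sign k ℚ.* alternate 0ℚ 0ℚ (suc k) ≡ 0ℚ
          w₁ = x*0≡0 (sign k) (alternate-suc-k 0ℚ 0ℚ)

        triv : ∀ {x} → Kernel A S x → (∀ {i} → i < 0 → x (u i) ≡ 0ℚ) → ∀ i → x i ≡ 0ℚ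
        triv {x} ker _ = kernel-trivial ker
          (negated 0 (trans (cong (y ker) k≡) (2-periodic-even (y ker) (y-2-periodic ker) h)))
          (negated 1 (trans (cong (y ker ∘ suc) k≡) (2-periodic-odd (y ker) (y-2-periodic ker) h)))
          where
          negated : ∀ i → y ker (i + k) ≡ y ker i → y ker i ≡ 0ℚ
          negated i eq = neg-fixed⇒0 (y ker i) (begin
            y ker i                 ≡⟨ eq ⟨
            y ker (i + k)           ≡⟨ y-shift ker i ⟩
            sign k ℚ.* y ker i      ≡⟨ cong (ℚ._* y ker i) s≡-1 ⟩
            ℚ.- 1ℚ ℚ.* y ker i      ≡⟨ ℚₚ.neg-distribˡ-* 1ℚ (y ker i) ⟨
            ℚ.- (1ℚ ℚ.* y ker i)    ≡⟨ cong ℚ.-_ (ℚₚ.*-identityˡ (y ker i)) ⟩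
            ℚ.- y ker i             ∎)
            where open ≡-Reasoning

-- Matchings of the cycle and saturation

module CycleMatchings {n k-1} {G : OrientedGraph n} (C : Cycle G (suc k-1)) (uniq : IsUniqueCycle C) where

  open OnCycle C uniq

  ε : ℕ → Edge n
  ε i = orient G (u-adjacent i)

  ε-arc : ∀ i → OrientedGraph.Arc G (proj₁ (ε i)) (proj₂ (ε i))
  ε-arc i = orient-arc G (u-adjacent i)

  ε-left : ∀ i → Incident (u i) (ε i)
  ε-left i = orient-left G (u-adjacent i)

  ε-right : ∀ i → Incident (u (suc i)) (ε i)
  ε-right i = orient-right G (u-adjacent i)

  ε-incident : ∀ {x} i → Incident x (ε i) → x ≡ u i ⊎ x ≡ u (suc i)
  ε-incident i = orient-incident G (u-adjacent i)

  ε-⊆ : ∀ {x} i → Incident x (ε i) → x ∈ˢ S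
  ε-⊆ i xe with ε-incident i xe
  ... | inj₁ refl = u∈S i
  ... | inj₂ refl = u∈S (suc i)

  ε-≢-suc : ∀ i → ε i ≢ ε (suc i)
  ε-≢-suc i eq with ε-incident i (subst (Incident (u (2 + i))) (sym eq) (ε-right (suc i)))
  ... | inj₁ e = u-≢-2 i (sym e)
  ... | inj₂ e = adjacent-irrefl G (u-adjacent (suc i)) (sym e)

  ε-complete : ∀ i {e} → uncurry (OrientedGraph.Arc G) e → (∀ {x} → Incident x e → x ∈ˢ S) →
    Incident (u (suc i)) e → e ≡ ε i ⊎ e ≡ ε (suc i)
  ε-complete i {b , c} bc within-S (inj₁ refl) with u-neighbours i (within-S (inj₂ refl)) (fwd bc)
  ... | inj₁ refl = inj₁ (arc-orient G bc (u-adjacent i) (inj₂ refl) (inj₁ refl))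
  ... | inj₂ refl = inj₂ (arc-orient G bc (u-adjacent (suc i)) (inj₁ refl) (inj₂ refl))
  ε-complete i {b , c} bc within-S (inj₂ refl) with u-neighbours i (within-S (inj₁ refl)) (bwd bc)
  ... | inj₁ refl = inj₁ (arc-orient G bc (u-adjacent i) (inj₁ refl) (inj₂ refl))
  ... | inj₂ refl = inj₂ (arc-orient G bc (u-adjacent (suc i)) (inj₂ refl) (inj₁ refl))

  -- For k ≡ h * 2 these are, with b = 0 and b = 1, the two perfect matchings of C.
  everySecond : ℕ → ℕ → List (Edge n)
  everySecond b h = applyUpTo (λ j → ε (b + j * 2)) h

  module _ (b h : ℕ) (2h≤k : h * 2 ≤ k) where

    bounds : ∀ {j} → j < h → suc (j * 2) < k
    bounds j<h = ℕₚ.<-≤-trans (ℕₚ.*-monoˡ-≤ 2 j<h) 2h≤k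

    -- Counted from `b`, the ends of edge `i` have offsets `i * 2` and `suc (i * 2)`, all below `k`.
    -- Equal offsets identify the edges, and parity excludes the mixed cases.
    everySecond-meet : ∀ {i j x} → i < h → j < h →
      Incident x (ε (b + i * 2)) → Incident x (ε (b + j * 2)) → i ≡ j
    everySecond-meet {i} {j} i<h j<h xi xj with ε-incident (b + i * 2) xi | ε-incident (b + j * 2) xj
    ... | inj₁ p | inj₁ q = ℕₚ.*-cancelʳ-≡ i j 2
      (u-injective b (ℕₚ.<⇒≤ (bounds i<h)) (ℕₚ.<⇒≤ (bounds j<h)) (trans (sym p) q))
    ... | inj₁ p | inj₂ q = contradiction
      (u-injective b (ℕₚ.<⇒≤ (bounds i<h)) (bounds j<h)
        (trans (trans (sym p) q) (cong u (sym (ℕₚ.+-suc b (j * 2))))))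
      (even≢odd i j)
    ... | inj₂ p | inj₁ q = contradiction
      (u-injective b (ℕₚ.<⇒≤ (bounds j<h)) (bounds i<h)
        (trans (trans (sym q) p) (cong u (sym (ℕₚ.+-suc b (i * 2))))))
      (even≢odd j i)
    ... | inj₂ p | inj₂ q = ℕₚ.*-cancelʳ-≡ i j 2 (ℕₚ.suc-injective
      (u-injective b (bounds i<h) (bounds j<h)
        (trans (cong u (ℕₚ.+-suc b (i * 2))) (trans (trans (sym p) q) (cong u (sym (ℕₚ.+-suc b (j * 2))))))))

    everySecond-matching : Matching G S (everySecond b h)
    everySecond-matching = record
      { arc    = arc′
      ; within = within′
      ; meet   = meet′
      ; unique = Unique.applyUpTo⁺₁ (λ j → ε (b + j * 2)) h λ {i} {j} i<j j<h eq → ℕₚ.<⇒≢ i<j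
          (everySecond-meet (ℕₚ.<-trans i<j j<h) j<h (ε-left (b + i * 2))
            (subst (Incident (u (b + i * 2))) eq (ε-left (b + i * 2))))
      }
      where
      arc′ : ∀ {x y} → (x , y) ∈ everySecond b h → OrientedGraph.Arc G x y
      arc′ e∈ with ∈-applyUpTo⁻ (λ j → ε (b + j * 2)) e∈
      ... | j , _ , refl = ε-arc (b + j * 2)
      within′ : ∀ {e x} → e ∈ everySecond b h → Incident x e → x ∈ˢ S
      within′ e∈ xe with ∈-applyUpTo⁻ (λ j → ε (b + j * 2)) e∈
      ... | j , _ , refl = ε-⊆ (b + j * 2) xe
      meet′ : ∀ {e f x} → e ∈ everySecond b h → f ∈ everySecond b h → Incident x e → Incident x f → e ≡ f
      meet′ e∈ f∈ xe xf
        with ∈-applyUpTo⁻ (λ j → ε (b + j * 2)) e∈ | ∈-applyUpTo⁻ (λ j → ε (b + j * 2)) f∈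
      ... | i , i<h , refl | j , j<h , refl = cong (λ t → ε (b + t * 2)) (everySecond-meet i<h j<h xe xf)

  cycleVertices : List (Fin n)
  cycleVertices = applyUpTo u k

  ends-⊆-cycle : ∀ {M} → Matching G S M → ends M ⊆ cycleVertices
  ends-⊆-cycle isM x∈ with ∈ends⁻ x∈
  ... | e , e∈ , xe with ∈S⁻ (within isM e∈ xe)
  ...   | i , i<k , refl = ∈-applyUpTo⁺ u i<k

  cycle-matching-length : ∀ {M} → Matching G S M → length M * 2 ≤ k
  cycle-matching-length {M} isM = subst₂ _≤_ (length-ends M) (length-applyUpTo u k)
    (Unique⊆⇒length≤ (ends-unique isM) (ends-⊆-cycle isM))

  -- The two bounds say that `h` is half of `k` rounded down, so even and odd cycles are treated
  -- together. The upper bound counts ends: a matching has twice as many ends as edges, all among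
  -- the `k` vertices.
  everySecond-maximum : ∀ b h → h * 2 ≤ k → k ≤ suc (h * 2) → MaximumMatching G S (everySecond b h)
  everySecond-maximum b h 2h≤k k≤2h+1 = record
    { matching = everySecond-matching b h 2h≤k
    ; maximum  = λ {N} isN → subst (length N ≤_) (sym (length-applyUpTo _ h))
        (halve (length N) h (ℕₚ.≤-trans (cycle-matching-length isN) k≤2h+1))
    }
    where
    halve : ∀ i j → i * 2 ≤ suc (j * 2) → i ≤ j
    halve zero    j       _             = z≤n
    halve (suc i) (suc j) (s≤s (s≤s q)) = s≤s (halve i j q)
    halve (suc i) zero    (s≤s ())

  Covered : List (Edge n) → Fin n → Set
  Covered M x = ∃[ e ] e ∈ M × Incident x e × (∀ {y} → Incident y e → y ∈ˢ S)

  -- For a matching and even `k`, the same as containing one of the two perfect matchings of `C`.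
  -- Being stated vertex by vertex, it can be followed through the removal of one edge.
  Saturated : List (Edge n) → Set
  Saturated M = ∀ i → Covered M (u i)

  saturated-⊆ : ∀ {M N} → M ⊆ N → Saturated M → Saturated N
  saturated-⊆ M⊆N sat i with sat i
  ... | e , e∈ , rest = e , M⊆N e∈ , rest

  perfect⇒saturated : ∀ {M} → Matching G S M → length M * 2 ≡ k → Saturated M
  perfect⇒saturated {M} isM len i with ∈S⁻ (u∈S i)
  ... | j , j<k , eq with ∈ends⁻ (Unique⊆∧length≥⇒⊇ _≟ᶠ_ (ends-unique isM) (ends-⊆-cycle isM)
          (ℕₚ.≤-reflexive (trans (length-applyUpTo u k) (trans (sym len) (sym (length-ends M)))))
          (∈-applyUpTo⁺ u j<k))
  ...   | e , e∈ , xe = e , e∈ , subst (λ x → Incident x e) (sym eq) xe , within isM e∈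

  -- The claim can fail only if `e₀`, joining `v` and `w`, lies within `C`. But the other neighbour
  -- of `v` on `C` is then saturated by an edge of `M`, so it belongs to `W`, where `w` is the only
  -- neighbour of `v`.
  pendant-saturated : ∀ {W v w M} (pen : Pendant G W v w) → Matching G (W - v - w) M →
    Saturated (e₀ pen ∷ M) → Saturated M
  pendant-saturated {W} {v} {w} {M} pen isM sat i with sat i
  ... | e , there e∈ , rest = e , e∈ , rest
  ... | _ , here refl , _ , e₀⊆S with ∈S⁻-suc (e₀⊆S (orient-left G (edge pen)))
  ...   | j , refl = ⊥-elim (impossible (u-neighbours j (e₀⊆S (orient-right G (edge pen))) (edge pen)))
    where
    other-neighbour : ∀ l → u l ≢ w → ¬ Adjacent G (u (suc j)) (u l)
    other-neighbour l ul≢w adj with sat l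
    ... | _ , here refl , xe , _ = case orient-incident G (edge pen) xe of λ
      { (inj₁ eq) → adjacent-irrefl G adj (sym eq) ; (inj₂ eq) → ul≢w eq }
    ... | e , there e∈ , xe , _ = ul≢w (only pen (x∈p-y⇒x∈p (x∈p-y⇒x∈p (within isM e∈ xe))) adj)

    impossible : ¬ (w ≡ u j ⊎ w ≡ u (2 + j))
    impossible (inj₁ w≡) =
      other-neighbour (2 + j) (λ eq → u-≢-2 j (sym (trans eq w≡))) (u-adjacent (suc j))
    impossible (inj₂ w≡) =
      other-neighbour j (λ eq → u-≢-2 j (trans eq w≡)) (adjacent-sym G (u-adjacent j))

  -- The empty matching misses `u 0`; putting the pendant edges back keeps the matching maximum and,
  -- by the contrapositive of `pendant-saturated`, unsaturated.
  unsaturated-maximum : ∀ {W p} → Elimination G ∅ W p → ∃[ M ] MaximumMatching G W M × ¬ Saturated M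
  unsaturated-maximum stop = [] , ∅-maximum , λ sat → case sat 0 of λ ()
  unsaturated-maximum (isolated v∈W alone el) with unsaturated-maximum el
  ... | M , isMax , ¬sat = M , isolated-maximum⁺ alone isMax , ¬sat
  unsaturated-maximum (pendant pen el) with unsaturated-maximum el
  ... | M , isMax , ¬sat =
    e₀ pen ∷ M , extend-maximum pen isMax , ¬sat ∘ pendant-saturated pen (matching isMax)

  module _ (h : ℕ) (k≡ : k ≡ h * 2) where

    2h≤k : h * 2 ≤ k
    2h≤k = ℕₚ.≤-reflexive (sym k≡)

    k≤2h+1 : k ≤ suc (h * 2)
    k≤2h+1 = ℕₚ.m≤n⇒m≤1+n (ℕₚ.≤-reflexive k≡)

    everySecond-saturated : ∀ b → Saturated (everySecond b h)
    everySecond-saturated b = perfect⇒saturated (everySecond-matching b h 2h≤k)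
      (trans (cong (_* 2) (length-applyUpTo _ h)) (sym k≡))

    -- Every maximum matching of `W` contains a maximum matching of `C`, which is perfect because
    -- `k` is even.
    saturated-maximum : ∀ {W p M} → Elimination G S W p → MaximumMatching G W M → Saturated M
    saturated-maximum el isMax with eliminate-restrict el isMax
    ... | N , N⊆M , isMaxN = saturated-⊆ N⊆M (perfect⇒saturated (matching isMaxN)
      (trans (cong (_* 2) (ℕₚ.≤-antisym
          (maximum (everySecond-maximum 0 h 2h≤k k≤2h+1) (matching isMaxN))
          (maximum isMaxN (everySecond-matching 0 h 2h≤k))))
        (trans (cong (_* 2) (length-applyUpTo _ h)) (sym k≡))))

    module _ {W M} (isM : Matching G W M) where

      not-consecutive : ∀ i → ε i ∈ M → ε (suc i) ∉ M
      not-consecutive i εi∈ εi+1∈ = ε-≢-suc i (meet isM εi∈ εi+1∈ (ε-right i) (ε-left (suc i)))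

      not-both : everySecond 0 h ⊆ M → ¬ everySecond 1 h ⊆ M
      not-both sub₀ sub₁ = not-consecutive 0
        (sub₀ (∈-applyUpTo⁺ (λ j → ε (j * 2)) 0<h)) (sub₁ (∈-applyUpTo⁺ (λ j → ε (suc (j * 2))) 0<h))
        where
        -- For `h` equal to 0 both lists would be empty and thus contained in `M`.
        0<h : 0 < h
        0<h = ℕₚ.*-cancelʳ-< 2 0 h (subst (0 <_) k≡ z<s)

      module _ (sat : Saturated M) where

        covering : ∀ i → ε i ∈ M ⊎ ε (suc i) ∈ M
        covering i with sat (suc i)
        ... | e , e∈ , xe , e⊆S with ε-complete i (arc isM e∈) e⊆S xe
        ...   | inj₁ refl = inj₁ e∈
        ...   | inj₂ refl = inj₂ e∈

        -- Of two consecutive edges of `C`, at least one is in `M` by saturation and at most one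
        -- because they meet, so membership alternates around the cycle.
        propagate : ∀ b → ε b ∈ M → ∀ j → ε (b + j * 2) ∈ M
        propagate b εb∈ zero = subst (λ t → ε t ∈ M) (sym (ℕₚ.+-identityʳ b)) εb∈
        propagate b εb∈ (suc j) with covering (suc (b + j * 2))
        ... | inj₁ ε∈ = contradiction ε∈ (not-consecutive (b + j * 2) (propagate b εb∈ j))
        ... | inj₂ ε∈ = subst (λ t → ε t ∈ M) b+2 ε∈
          where
          b+2 : 2 + (b + j * 2) ≡ b + suc j * 2
          b+2 = sym (trans (ℕₚ.+-suc b (suc (j * 2))) (cong suc (ℕₚ.+-suc b (j * 2))))

        everySecond-⊆ : ∀ b → ε b ∈ M → everySecond b h ⊆ M
        everySecond-⊆ b εb∈ e∈ with ∈-applyUpTo⁻ (λ j → ε (b + j * 2)) e∈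
        ... | j , _ , refl = propagate b εb∈ j

        saturated⇒⊇everySecond : everySecond 0 h ⊆ M ⊎ everySecond 1 h ⊆ M
        saturated⇒⊇everySecond with covering 0
        ... | inj₁ ε0∈ = inj₁ (everySecond-⊆ 0 ε0∈)
        ... | inj₂ ε1∈ = inj₂ (everySecond-⊆ 1 ε1∈)

-- Counting the matchings that contain a given perfect matching of a vertex set

element-injective : ∀ {n} (W : Subset n) {i j} → element W i ≡ element W j → i ≡ j
element-injective (inside  ∷ W) {zero}  {zero}  eq = refl
element-injective (inside  ∷ W) {suc i} {suc j} eq = cong suc (element-injective W (suc-injective eq))
element-injective (outside ∷ W) eq = element-injective W (suc-injective eq)

element-∈ : ∀ {n} (W : Subset n) i → element W i ∈ˢ W
element-∈ (inside  ∷ W) zero    = hereᵛ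
element-∈ (inside  ∷ W) (suc i) = thereᵛ (element-∈ W i)
element-∈ (outside ∷ W) i       = thereᵛ (element-∈ W i)

element-surjective : ∀ {n} {W : Subset n} {x} → x ∈ˢ W → ∃[ i ] element W i ≡ x
element-surjective {W = inside  ∷ W} hereᵛ = zero , refl
element-surjective {W = inside  ∷ W} (thereᵛ x∈W) with element-surjective x∈W
... | i , refl = suc i , refl
element-surjective {W = outside ∷ W} (thereᵛ x∈W) with element-surjective x∈W
... | i , refl = i , refl

map-unique : ∀ {A B : Set} (f : A → B) {xs} → (∀ {x y} → x ∈ xs → y ∈ xs → f x ≡ f y → x ≡ y) →
  Unique xs → Unique (map f xs)
map-unique f inj [] = []
map-unique f {x ∷ xs} inj (x≢ ∷ u) = ∉∷-unique fresh (map-unique f (λ y∈ z∈ → inj (there y∈) (there z∈)) u)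
  where
  fresh : f x ∉ map f xs
  fresh fx∈ with ∈-map⁻ f fx∈
  ... | y , y∈ , eq = All.lookup x≢ y∈ (inj (here refl) (there y∈) eq)

matchingsOfSize : ∀ {n} → OrientedGraph n → ℕ → List (List (Edge n))
matchingsOfSize G i = filter (λ M → length M ℕₚ.≟ i) (matchings G)

module _ {n} (G : OrientedGraph n) {i : ℕ} where

  ∈matchingsOfSize⁻ : ∀ {M} → M ∈ matchingsOfSize G i → M ∈ matchings G × length M ≡ i
  ∈matchingsOfSize⁻ = ∈-filter⁻ (λ M → length M ℕₚ.≟ i) {xs = matchings G}

  ∈matchingsOfSize⁺ : ∀ {M} → M ∈ matchings G → length M ≡ i → M ∈ matchingsOfSize G i
  ∈matchingsOfSize⁺ = ∈-filter⁺ (λ M → length M ℕₚ.≟ i)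

  matchingsOfSize-unique : Unique (matchingsOfSize G i)
  matchingsOfSize-unique = Unique.filter⁺ (λ M → length M ℕₚ.≟ i) (matchings-unique {G = G})

contains? : ∀ {n} (K M : List (Edge n)) → Dec (All (_∈ M) K)
contains? K M = All.all? (_∈ᴱ? M) K

-- Removing K is a bijection from the matchings containing K to the matchings
-- of the graph without the vertices S covered by K.
module Containing {n} (G : OrientedGraph n) (S : Subset n) {K} (isK : Matching G S K)
  (covers : ∀ {x} → x ∈ˢ S → ∃[ e ] e ∈ K × Incident x e) where

  W : Subset n
  W = ∁ S

  H : OrientedGraph ∣ W ∣
  H = induced G W

  embed : Edge ∣ W ∣ → Edge n
  embed (b , c) = element W b , element W c

  embed-injective : ∀ {e f} → embed e ≡ embed f → e ≡ f
  embed-injective eq =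
    cong₂ _,_ (element-injective W (cong proj₁ eq)) (element-injective W (cong proj₂ eq))

  incident-embed⁺ : ∀ {x} e → Incident x e → Incident (element W x) (embed e)
  incident-embed⁺ _ (inj₁ refl) = inj₁ refl
  incident-embed⁺ _ (inj₂ refl) = inj₂ refl

  incident-embed⁻ : ∀ {y} e → Incident y (embed e) → ∃[ x ] y ≡ element W x × Incident x e
  incident-embed⁻ (b , _) (inj₁ refl) = b , refl , inj₁ refl
  incident-embed⁻ (_ , c) (inj₂ refl) = c , refl , inj₂ refl

  embed-outside : ∀ {y} e → Incident y (embed e) → y ∉ˢ S
  embed-outside e ye with incident-embed⁻ e ye
  ... | x , refl , _ = Subset.x∈∁p⇒x∉p (element-∈ W x)

  embed∉K : ∀ e → embed e ∉ K
  embed∉K e e∈K = embed-outside e (inj₁ refl) (within isK e∈K (inj₁ refl))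

  join : List (Edge ∣ W ∣) → List (Edge n)
  join N = K ++ map embed N

  join-matching : ∀ {N} → Matching H Full N → Matching G Full (join N)
  join-matching {N} isN = record
    { arc    = λ e∈ → [ arc isK , arc′ ]′ (∈-++⁻ K e∈)
    ; within = λ _ _ → Subset.∈⊤
    ; meet   = λ e∈ f∈ → meet′ (∈-++⁻ K e∈) (∈-++⁻ K f∈)
    ; unique = Unique.++⁺ (unique isK) (Unique.map⁺ embed-injective (unique isN))
        λ (e∈K , e∈N) → case ∈-map⁻ embed e∈N of λ { (e , _ , refl) → embed∉K e e∈K }
    }
    where
    arc′ : ∀ {x y} → (x , y) ∈ map embed N → OrientedGraph.Arc G x y
    arc′ e∈ with ∈-map⁻ embed e∈
    ... | _ , e∈N , refl = arc isN e∈N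

    meet′ : ∀ {e f x} → e ∈ K ⊎ e ∈ map embed N → f ∈ K ⊎ f ∈ map embed N →
      Incident x e → Incident x f → e ≡ f
    meet′ (inj₁ e∈) (inj₁ f∈) xe xf = meet isK e∈ f∈ xe xf
    meet′ (inj₁ e∈) (inj₂ f∈) xe xf with ∈-map⁻ embed f∈
    ... | f , _ , refl = contradiction (within isK e∈ xe) (embed-outside f xf)
    meet′ (inj₂ e∈) (inj₁ f∈) xe xf with ∈-map⁻ embed e∈
    ... | e , _ , refl = contradiction (within isK f∈ xf) (embed-outside e xe)
    meet′ (inj₂ e∈) (inj₂ f∈) xe xf with ∈-map⁻ embed e∈ | ∈-map⁻ embed f∈
    ... | e , e∈N , refl | f , f∈N , refl with incident-embed⁻ e xe | incident-embed⁻ f xf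
    ...   | b , refl , be | c , eq , cf with element-injective W eq
    ...     | refl = cong embed (meet isN e∈N f∈N be cf)

  length-join : ∀ N → length (join N) ≡ length K + length N
  length-join N = trans (length-++ K) (cong (length K +_) (length-map embed N))

  -- `join N` need not follow the order of `edges G`, whereas the entries of `matchings G` do.
  joined : List (Edge ∣ W ∣) → List (Edge n)
  joined N = ordered {G = G} (join N)

  joined∈matchings : ∀ {N} → N ∈ matchings H → joined N ∈ matchings G
  joined∈matchings N∈ = ordered∈matchings (join-matching (∈matchings⇒Matching {G = H} N∈))

  length-joined : ∀ {N} → N ∈ matchings H → length (joined N) ≡ length K + length N
  length-joined {N} N∈ =
    trans (ordered-length (join-matching (∈matchings⇒Matching {G = H} N∈))) (length-join N)

  joined-⊆⁻ : ∀ {N N′} → N ∈ matchings H → joined N ⊆ joined N′ → N ⊆ N′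
  joined-⊆⁻ {N} {N′} N∈ sub {e} e∈N
    with ∈-++⁻ K (ordered-⊆ {G = G} {join N′} (sub
           (ordered-⊇ (join-matching (∈matchings⇒Matching {G = H} N∈)) (∈-++⁺ʳ K (∈-map⁺ embed e∈N)))))
  ... | inj₁ e∈K = contradiction e∈K (embed∉K e)
  ... | inj₂ e∈N′ with ∈-map⁻ embed e∈N′
  ...   | f , f∈ , eq = subst (_∈ N′) (sym (embed-injective eq)) f∈

  joined-injective : ∀ {N N′} → N ∈ matchings H → N′ ∈ matchings H → joined N ≡ joined N′ → N ≡ N′
  joined-injective N∈ N′∈ eq = matchings-ext {G = H} N∈ N′∈
    (joined-⊆⁻ N∈ (subst (_ ∈_) eq)) (joined-⊆⁻ N′∈ (subst (_ ∈_) (sym eq)))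

  -- An edge of `M` outside `K` has no end in `S`, since each vertex of `S` is already covered by an
  -- edge of `K`, which is also in `M`. So it comes from an edge of `H`.
  joined-surjective : ∀ {M} → M ∈ matchings G → K ⊆ M → ∃[ N ] N ∈ matchings H × joined N ≡ M
  joined-surjective {M} M∈ K⊆M = N , N∈ ,
    matchings-ext {G = G} (joined∈matchings N∈) M∈ (join⊆M ∘ ordered-⊆ {G = G} {join N})
      (ordered-⊇ (join-matching (∈matchings⇒Matching {G = H} N∈)) ∘ M⊆join)
    where
    isM : Matching G Full M
    isM = ∈matchings⇒Matching {G = G} M∈

    N : List (Edge ∣ W ∣)
    N = filter (λ e → embed e ∈ᴱ? M) (edges H)

    ∈N⁻ : ∀ {e} → e ∈ N → embed e ∈ M
    ∈N⁻ e∈ = proj₂ (∈-filter⁻ (λ e → embed e ∈ᴱ? M) {xs = edges H} e∈)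

    N∈ : N ∈ matchings H
    N∈ = ∈-filter⁺ (allPairs? (disjoint? {∣ W ∣})) (filter∈sublists (λ e → embed e ∈ᴱ? M) (edges H))
      (pairwiseDisjoint {G = H}
        (λ {e} {f} e∈ f∈ xe xf → embed-injective
          (meet isM (∈N⁻ e∈) (∈N⁻ f∈) (incident-embed⁺ e xe) (incident-embed⁺ f xf)))
        (Unique.filter⁺ (λ e → embed e ∈ᴱ? M) (edges-unique {G = H})))

    join⊆M : join N ⊆ M
    join⊆M e∈ with ∈-++⁻ K e∈
    ... | inj₁ e∈K = K⊆M e∈K
    ... | inj₂ e∈N with ∈-map⁻ embed e∈N
    ...   | e , e∈ , refl = ∈N⁻ e∈

    M⊆join : M ⊆ join N
    M⊆join {e} e∈M with e ∈ᴱ? K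
    ... | yes e∈K = ∈-++⁺ˡ e∈K
    ... | no e∉K with element-surjective (outside-S (inj₁ refl)) | element-surjective (outside-S (inj₂ refl))
      where
      outside-S : ∀ {x} → Incident x e → x ∈ˢ W
      outside-S xe = Subset.x∉p⇒x∈∁p λ x∈S → case covers x∈S of λ
        { (f , f∈K , xf) → e∉K (subst (_∈ K) (meet isM (K⊆M f∈K) e∈M xf xe) f∈K) }
    ...   | b , refl | c , refl = ∈-++⁺ʳ K (∈-map⁺ embed
      (∈-filter⁺ (λ e → embed e ∈ᴱ? M) (∈edges⁺ {G = H} (arc isM e∈M)) e∈M))

  count-containing : ∀ {i} → length K ≤ i →
    length (filter (contains? K) (matchingsOfSize G i)) ≡ m H (i ∸ length K)
  count-containing {i} K≤i = sym (trans (sym (length-map joined small))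
    (Unique⊆⊇⇒length≡ unique-joined (Unique.filter⁺ (contains? K) (matchingsOfSize-unique G))
      joined⊆ ⊆joined))
    where
    small = matchingsOfSize H (i ∸ length K)
    large = filter (contains? K) (matchingsOfSize G i)

    unique-joined : Unique (map joined small)
    unique-joined = map-unique joined
      (λ N∈ N′∈ → joined-injective (proj₁ (∈matchingsOfSize⁻ H N∈)) (proj₁ (∈matchingsOfSize⁻ H N′∈)))
      (matchingsOfSize-unique H)

    joined⊆ : map joined small ⊆ large
    joined⊆ M∈ with ∈-map⁻ joined M∈
    ... | N , N∈ , refl with ∈matchingsOfSize⁻ H N∈
    ...   | N∈′ , len = ∈-filter⁺ (contains? K)
      (∈matchingsOfSize⁺ G (joined∈matchings N∈′)
        (trans (length-joined N∈′) (trans (cong (length K +_) len) (ℕₚ.m+[n∸m]≡n K≤i))))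
      (All.tabulate λ e∈K → ordered-⊇ (join-matching (∈matchings⇒Matching {G = H} N∈′)) (∈-++⁺ˡ e∈K))

    ⊆joined : large ⊆ map joined small
    ⊆joined M∈ with ∈-filter⁻ (contains? K) {xs = matchingsOfSize G i} M∈
    ... | M∈′ , K⊆M with ∈matchingsOfSize⁻ G M∈′
    ...   | M∈″ , len with joined-surjective M∈″ (All.lookup K⊆M)
    ...     | N , N∈ , refl = ∈-map⁺ joined (∈matchingsOfSize⁺ H N∈
      (trans (sym (ℕₚ.m+n∸m≡n (length K) (length N)))
        (cong (_∸ length K) (trans (sym (length-joined N∈)) len))))

module _ {A : Set} {P Q : A → Set} (P? : Decidable P) (Q? : Decidable Q) {xs : List A}
  (uniq : Unique xs) (exclusive : ∀ {x} → x ∈ xs → P x → ¬ Q x) where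

  private
    both : List A
    both = filter P? xs ++ filter Q? xs

    both-unique : Unique both
    both-unique = Unique.++⁺ (Unique.filter⁺ P? uniq) (Unique.filter⁺ Q? uniq) λ (x∈P , x∈Q) →
      exclusive (proj₁ (∈-filter⁻ P? x∈P)) (proj₂ (∈-filter⁻ P? {xs = xs} x∈P))
        (proj₂ (∈-filter⁻ Q? {xs = xs} x∈Q))

    both-⊆ : both ⊆ xs
    both-⊆ x∈ = [ proj₁ ∘ ∈-filter⁻ P? , proj₁ ∘ ∈-filter⁻ Q? ]′ (∈-++⁻ (filter P? xs) x∈)

  -- By exclusivity the two filtered lists together are repetition-free; an entry of `xs` in neither
  -- would make `xs` strictly longer than their total.
  count≡⇒covered : length xs ≡ length (filter P? xs) + length (filter Q? xs) →
    ∀ {x} → x ∈ xs → P x ⊎ Q x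
  count≡⇒covered eq {x} x∈ with P? x | Q? x
  ... | yes px | _      = inj₁ px
  ... | no _   | yes qx = inj₂ qx
  ... | no ¬px | no ¬qx = contradiction
    (Unique⊆⇒length≤ (∉∷-unique x∉both both-unique) λ { (here refl) → x∈ ; (there y∈) → both-⊆ y∈ })
    (ℕₚ.<⇒≱ (s≤s (ℕₚ.≤-reflexive (trans eq (sym (length-++ (filter P? xs)))))))
    where
    x∉both : x ∉ both
    x∉both x∈both = [ ¬px ∘ proj₂ ∘ ∈-filter⁻ P? {xs = xs} , ¬qx ∘ proj₂ ∘ ∈-filter⁻ Q? {xs = xs} ]′
      (∈-++⁻ (filter P? xs) x∈both)

  covered⇒count≡ : (∀ {x} → x ∈ xs → P x ⊎ Q x) →
    length xs ≡ length (filter P? xs) + length (filter Q? xs)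
  covered⇒count≡ cov = trans
    (Unique⊆⊇⇒length≡ uniq both-unique
      (λ x∈ → [ ∈-++⁺ˡ ∘ ∈-filter⁺ P? x∈ , ∈-++⁺ʳ (filter P? xs) ∘ ∈-filter⁺ Q? x∈ ]′ (cov x∈)) both-⊆)
    (length-++ (filter P? xs))

even-or-odd : ∀ k → ∃[ h ] (k ≡ h * 2 ⊎ k ≡ suc (h * 2))
even-or-odd zero = 0 , inj₁ refl
even-or-odd (suc k) with even-or-odd k
... | h , inj₁ refl = h , inj₂ refl
... | h , inj₂ refl = suc h , inj₁ refl

-- The counting equation as saturation of all maximum matchings

module _ {n k-1} {G : OrientedGraph n} (C : Cycle G (suc k-1)) (uniq : IsUniqueCycle C)
  (h : ℕ) (k≡ : suc k-1 ≡ h * 2) where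

  open OnCycle C uniq using (S; u∈S; ∈S⁻; k)
  open CycleMatchings C uniq

  private
    β : ℕ
    β = matchingNumber G

  everySecond-length : ∀ b → length (everySecond b h) ≡ h
  everySecond-length b = length-applyUpTo _ h

  everySecond-covers : ∀ b {x} → x ∈ˢ S → ∃[ e ] e ∈ everySecond b h × Incident x e
  everySecond-covers b x∈S =
    let i , _ , x≡ui = ∈S⁻ x∈S
        e , e∈ , ui-e , _ = everySecond-saturated h k≡ b i
    in e , e∈ , subst (λ v → Incident v e) (sym x≡ui) ui-e

  h≤β : h ≤ β
  h≤β = subst (_≤ β) (everySecond-length 0) (length≤matchingNumber (everySecond-matching 0 h (2h≤k h k≡)))

  k/2≡h : suc k-1 / 2 ≡ h
  k/2≡h = trans (cong (_/ 2) k≡) (m*n/n≡m h 2)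

  count-everySecond : ∀ b → length (filter (contains? (everySecond b h)) (matchingsOfSize G β))
    ≡ m (G ─ C) (β ∸ suc k-1 / 2)
  count-everySecond b = trans
    (Containing.count-containing G S (everySecond-matching b h (2h≤k h k≡)) (everySecond-covers b)
      (subst (_≤ β) (sym (everySecond-length b)) h≤β))
    (cong (λ t → m (G ─ C) (β ∸ t)) (trans (everySecond-length b) (sym k/2≡h)))

  count-both : length (filter (contains? (everySecond 0 h)) (matchingsOfSize G β)) +
    length (filter (contains? (everySecond 1 h)) (matchingsOfSize G β)) ≡ 2 * m (G ─ C) (β ∸ suc k-1 / 2)
  count-both = trans (cong₂ _+_ (count-everySecond 0) (count-everySecond 1))
    (cong (c +_) (sym (ℕₚ.+-identityʳ c)))
    where c = m (G ─ C) (β ∸ suc k-1 / 2)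

  exclusive : ∀ {M} → M ∈ matchingsOfSize G β → All (_∈ M) (everySecond 0 h) → ¬ All (_∈ M) (everySecond 1 h)
  exclusive M∈ in₀ in₁ = not-both h k≡ (∈matchings⇒Matching {G = G} (proj₁ (∈matchingsOfSize⁻ G M∈)))
    (All.lookup in₀) (All.lookup in₁)

  count⇒saturated : m G β ≡ 2 * m (G ─ C) (β ∸ suc k-1 / 2) →
    ∀ {M} → M ∈ matchingsOfSize G β → Saturated M
  count⇒saturated eq M∈ =
    [ (λ in₀ → saturated-⊆ (All.lookup in₀) (everySecond-saturated h k≡ 0))
    , (λ in₁ → saturated-⊆ (All.lookup in₁) (everySecond-saturated h k≡ 1))
    ]′ (count≡⇒covered (contains? (everySecond 0 h)) (contains? (everySecond 1 h))
         (matchingsOfSize-unique G) exclusive (trans eq (sym count-both)) M∈)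

  saturated⇒count : (∀ {M} → M ∈ matchingsOfSize G β → Saturated M) →
    m G β ≡ 2 * m (G ─ C) (β ∸ suc k-1 / 2)
  saturated⇒count sat = trans
    (covered⇒count≡ (contains? (everySecond 0 h)) (contains? (everySecond 1 h))
      (matchingsOfSize-unique G) exclusive covered)
    count-both
    where
    covered : ∀ {M} → M ∈ matchingsOfSize G β → All (_∈ M) (everySecond 0 h) ⊎ All (_∈ M) (everySecond 1 h)
    covered M∈ with saturated⇒⊇everySecond h k≡
                      (∈matchings⇒Matching {G = G} (proj₁ (∈matchingsOfSize⁻ G M∈))) (sat M∈)
    ... | inj₁ sub = inj₁ (All.tabulate sub)
    ... | inj₂ sub = inj₂ (All.tabulate sub)

-- Rank and matching number at the end of the reduction

maximum∈matchings : ∀ {n} {G : OrientedGraph n} {M} → MaximumMatching G Full M →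
  ordered {G = G} M ∈ matchingsOfSize G (matchingNumber G)
maximum∈matchings {G = G} isMax = ∈matchingsOfSize⁺ G (ordered∈matchings (matching isMax))
  (trans (ordered-length (matching isMax)) (maximum-length isMax))

∈matchings⇒maximum : ∀ {n} {G : OrientedGraph n} {M} →
  M ∈ matchingsOfSize G (matchingNumber G) → MaximumMatching G Full M
∈matchings⇒maximum {G = G} M∈ with ∈matchingsOfSize⁻ G M∈
... | M∈′ , len = record
  { matching = ∈matchings⇒Matching {G = G} M∈′
  ; maximum  = λ {N} isN → subst (length N ≤_) (sym len) (length≤matchingNumber isN)
  }

elimination⇒rank : ∀ {n} {G : OrientedGraph n} {T p us} → Elimination G T Full p →
  ColumnBasis (skewAdjacency G) T us → HasSkewRank G (2 * p + length us)
elimination⇒rank {G = G} el basis with eliminate-columnBasis el basis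
... | vs , len , basis′ = subst (HasSkewRank G) len (columnBasis⇒hasRank basis′)

elimination⇒matchingNumber : ∀ {n} {G : OrientedGraph n} {T p M} → Elimination G T Full p →
  MaximumMatching G T M → matchingNumber G ≡ p + length M
elimination⇒matchingNumber el isMax with eliminate-maximum el isMax
... | N , len , isMax′ = trans (sym (maximum-length isMax′)) len

theorem4p2 : ∀ (n k : ℕ) (G : OrientedGraph n) (C : Cycle G k) →
    Connected G → IsUniqueCycle C →
    (Exceptional G C → HasSkewRank G (2 * matchingNumber G ∸ 2)) ×
    (¬ Exceptional G C → HasSkewRank G (2 * matchingNumber G))
theorem4p2 n zero G C _ uniq = contradiction (3≤k C) λ ()
theorem4p2 n (suc k-1) G C _ uniq = conclude (eliminate {C = C} uniq Full)
  where
  open OnCycle C uniq using (k; S; A; sign; evenly⇒sign; ¬evenly⇒sign;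
    odd-columnBasis; even-columnBasis; even-columnBasis⁻)
  open CycleMatchings C uniq
  β = matchingNumber G

  Conclusion : Set
  Conclusion = (Exceptional G C → HasSkewRank G (2 * β ∸ 2)) × (¬ Exceptional G C → HasSkewRank G (2 * β))

  half : Exceptional G C → ∃[ h ] k ≡ h * 2
  half (divides h k≡ , _) = h , k≡

  -- The rank is 2p and the matching number is `p`, so the exceptional case must be refuted: its
  -- counting equation would saturate the unsaturated maximum matching at hand.
  conclude-∅ : ∀ {p} → Elimination G ∅ Full p → Conclusion
  conclude-∅ {p} el = (λ exc → contradiction exc ¬exceptional) ,
    λ _ → subst (HasSkewRank G) rank≡ (elimination⇒rank el ∅-columnBasis)
    where
    rank≡ : 2 * p + 0 ≡ 2 * β
    rank≡ = trans (ℕₚ.+-identityʳ (2 * p))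
      (cong (2 *_) (sym (trans (elimination⇒matchingNumber el ∅-maximum) (ℕₚ.+-identityʳ p))))

    ¬exceptional : ¬ Exceptional G C
    ¬exceptional exc@(_ , _ , count) with half exc | unsaturated-maximum el
    ... | h , k≡ | M , isMax , ¬sat = ¬sat (saturated-⊆ (ordered-⊆ {G = G} {M})
      (count⇒saturated C uniq h k≡ count (maximum∈matchings isMax)))

  module _ {p} (h : ℕ) (el : Elimination G S Full p) (2h≤k : h * 2 ≤ k) (k≤2h+1 : k ≤ suc (h * 2)) where

    β≡ : β ≡ p + h
    β≡ = trans (elimination⇒matchingNumber el (everySecond-maximum 0 h 2h≤k k≤2h+1))
      (cong (p +_) (length-applyUpTo _ h))

    2β≡ : 2 * p + h * 2 ≡ 2 * β
    2β≡ = trans (cong (2 * p +_) (ℕₚ.*-comm h 2))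
      (trans (sym (ℕₚ.*-distribˡ-+ 2 p h)) (cong (2 *_) (sym β≡)))

    rank-from-basis : ∀ {r s us} → length us ≡ r → ColumnBasis A S us → 2 * p + r ≡ s → HasSkewRank G s
    rank-from-basis refl basis refl = elimination⇒rank el basis

  conclude-odd : ∀ {p} h → k ≡ suc (h * 2) → Elimination G S Full p → Conclusion
  conclude-odd {p} h k≡ el =
    (λ exc → contradiction (trans (sym (proj₂ (half exc))) k≡) (even≢odd (proj₁ (half exc)) h)) ,
    λ _ → let us , len , basis = odd-columnBasis h k≡ in
      rank-from-basis h el h*2≤k k≤1+h*2 len basis
        (trans (cong (λ t → 2 * p + (t ∸ 1)) k≡) (2β≡ h el h*2≤k k≤1+h*2))
    where
    h*2≤k : h * 2 ≤ k
    h*2≤k = ℕₚ.≤-trans (ℕₚ.n≤1+n (h * 2)) (ℕₚ.≤-reflexive (sym k≡))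
    k≤1+h*2 : k ≤ suc (h * 2)
    k≤1+h*2 = ℕₚ.≤-reflexive k≡

  module _ {p} (h : ℕ) (k≡ : k ≡ h * 2) (el : Elimination G S Full p) where

    2p+k≡2β : 2 * p + k ≡ 2 * β
    2p+k≡2β = trans (cong (2 * p +_) k≡) (2β≡ h el (2h≤k h k≡) (k≤2h+1 h k≡))

    conclude-oddly-oriented : ¬ EvenlyOriented C → Conclusion
    conclude-oddly-oriented ¬evenly =
      (λ (_ , evenly , _) → contradiction evenly ¬evenly) ,
      λ _ → let us , len , basis = even-columnBasis⁻ h k≡ (¬evenly⇒sign ¬evenly) in
        rank-from-basis h el (2h≤k h k≡) (k≤2h+1 h k≡) len basis 2p+k≡2β

    conclude-evenly-oriented : EvenlyOriented C → Conclusion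
    conclude-evenly-oriented evenly =
      (λ _ → let us , len , basis = even-columnBasis h k≡ (evenly⇒sign evenly) in
        rank-from-basis h el (2h≤k h k≡) (k≤2h+1 h k≡) len basis
          -- The kernel of dimension 2 accounts for the drop; moving the subtraction outside is
          -- allowed because `k` is at least 2.
          (trans (sym (ℕₚ.+-∸-assoc (2 * p) (ℕₚ.<⇒≤ (3≤k C)))) (cong (_∸ 2) 2p+k≡2β))) ,
      -- The rank is now below twice the matching number, so the second implication has to be
      -- vacuous: a reduction ending in `C` makes every maximum matching saturated, which is the
      -- counting equation.
      λ ¬exc → contradiction (divides h k≡ , evenly , count) ¬exc
      where
      count : m G β ≡ 2 * m (G ─ C) (β ∸ k / 2)
      count = saturated⇒count C uniq h k≡ (λ M∈ → saturated-maximum h k≡ el (∈matchings⇒maximum M∈))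

    conclude-even : Conclusion
    conclude-even = [ conclude-evenly-oriented , conclude-oddly-oriented ]′
      (toSum (0ℚ ℚₚ.<? ∏ (λ i → A (vertex C i) (vertex C (next i)))))

  conclude : ∃[ p ] (Elimination G ∅ Full p ⊎ Elimination G S Full p) → Conclusion
  conclude (p , inj₁ el) = conclude-∅ el
  conclude (p , inj₂ el) with even-or-odd k
  ... | h , inj₁ k≡ = conclude-even h k≡ el
  ... | h , inj₂ k≡ = conclude-odd h k≡ el
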